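{- Let $\phi(\bar v)$ be an $\mathrm{FO}(\perp\!\!\!\perp_c,\sim)[\tau]$-formula whose free variables are among $\bar v=(v_1,\dots,v_k)$. Then there is a formula $\psi_\phi(f)\in\mathrm{SO}_{d[0,1]}(\mathrm{SUM},\times)$ with exactly one free function variable $f$ ($k$-ary) such that for all finite $\tau$-structures $\mathcal A$ and all probabilistic teams $\mathbb X\colon X\to[0,1]$ over $\{v_1,\dots,v_k\}$: $\mathcal A\models_{\mathbb X}\phi(\bar v)$ iff $(\mathcal A,f_{\mathbb X})\models\psi_\phi(f)$, where $f_{\mathbb X}\colon A^k\to[0,1]$ is the probability distribution with $f_{\mathbb X}(s(\bar v))=\mathbb X(s)$ for all $s\in X$ (and $0$ elsewhere).
   Context: Probabilistic team semantics. Fix a finite relational vocabulary $\tau$ containing $=$; structures $\mathcal A$ are finite $\tau$-structures with universe $A$. An assignment over a finite set $D$ of first-order variables is a map $s\colon D\to A$; $s(a/x)$ maps $x$ to $a$ and agrees with $s$ elsewhere. A probabilistic team over $D$ is a function $\mathbb X\colon X\to[0,1]$ with $\sum_{s\in X}\mathbb X(s)=1$, where $X$ is a finite set of assignments over $D$ (zero weights allowed); $\mathrm{supp}(\mathbb X)=\{s:\mathbb X(s)\neq0\}$. For a tuple $\bar x$ and $\bar a\in A^{|\bar x|}$, $|\mathbb X_{\bar x=\bar a}|=\sum_{s\in X,\,s(\bar x)=\bar a}\mathbb X(s)$. For $F$ mapping each $t\in X$ to a probability distribution $F(t)$ on $A$, $\mathbb X(F/x)(s(a/x))=\sum_{t\in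 X,\ t(a/x)=s(a/x)}\mathbb X(t)\,F(t)(a)$; $\mathbb X(A/x)$ is $\mathbb X(F/x)$ with every $F(t)$ uniform on $A$. For $k\in[0,1]$, $\mathbb Y\sqcup_k\mathbb Z$ is $s\mapsto k\mathbb Y(s)+(1-k)\mathbb Z(s)$ (missing weights read as $0$). Syntax of $\mathrm{FO}(\perp\!\!\!\perp_c,\sim)$: $\phi::=R(\bar x)\mid\neg R(\bar x)\mid \bar y\perp\!\!\!\perp_{\bar x}\bar z\mid\sim\phi\mid\phi\wedge\phi\mid\phi\vee\phi\mid\exists x\phi\mid\forall x\phi$ with $R\in\tau$. Semantics: $R(\bar x)$ (resp. $\neg R(\bar x)$) holds in $\mathbb X$ iff every $s\in\mathrm{supp}(\mathbb X)$ satisfies it in the Tarskian sense; $\bar y\perp\!\!\!\perp_{\bar x}\bar z$ holds iff $|\mathbb X_{\bar x\bar y=s(\bar x\bar y)}|\cdot|\mathbb X_{\bar x\bar z=s(\bar x\bar z)}|=|\mathbb X_{\bar x\bar y\bar z=s(\bar x\bar y\bar z)}|\cdot|\mathbb X_{\bar x=s(\bar x)}|$ for all $s\colon\mathrm{Var}(\bar x\bar y\bar z)\to A$; $\sim\phi$ holds iff $\phi$ does not; $\wedge$ is classical; $\phi\vee\psi$ holds in $\mathbb X$ iff $\phi$ holds in $\mathbb Y$ and $\psi$ in $\mathbb Z$ for some $\mathbb Y,\mathbb Z,k$ with $\mathbb Y\sqcup_k\mathbb Z=\mathbb X$; $\exists x\phi$ holds in $\mathbb X$ iff $\phi$ holds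 in $\mathbb X(F/x)$ for some $F$; $\forall x\phi$ holds in $\mathbb X$ iff $\phi$ holds in $\mathbb X(A/x)$. $\mathrm{SO}_{d[0,1]}(\mathrm{SUM},\times)$: over $\mathbb R$-structures (finite $\tau$-structures expanded by functions $A^{\mathrm{Ar}(f)}\to\mathbb R$), numerical terms $i::=f(\bar x)\mid i\times i\mid\mathrm{SUM}_{\bar y}\,i$, where $\mathrm{SUM}_{\bar y}\,i$ under $s$ is $\sum_{\bar b\in A^{|\bar y|}}$ of $i$ under $s(\bar b/\bar y)$; formulas $i=j\mid\neg i=j\mid R(\bar x)\mid\neg R(\bar x)\mid\wedge\mid\vee\mid\exists x\mid\forall x\mid\exists f\mid\forall f$, with first-order quantifiers over $A$ and function quantifiers ranging over probability distributions on $A^{\mathrm{Ar}(f)}$. -}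

module Defs where

open import Algebra.Bundles using (CommutativeRing)
import Algebra.Properties.CommutativeMonoid.Sum as MonoidSum
import Algebra.Properties.Monoid.Mult as MonoidMult
open import Data.Empty using (⊥)
open import Data.Fin using (Fin; zero; suc)
import Data.Fin as Fin
open import Data.List using (List; []; _∷_; _++_; length; cartesianProductWith)
import Data.List as List
open import Data.List.Membership.Propositional using (_∈_)
import Data.List.Membership.DecPropositional as DecMembership
open import Data.List.Relation.Unary.All using (All; []; _∷_)
import Data.List.Relation.Unary.All as All
open import Data.List.Relation.Unary.Any using (here; index)
open import Data.Nat using (ℕ; zero; suc)
import Data.Nat as ℕ
open import Data.Product using (Σ-syntax; ∃; ∃-syntax; _×_; _,_; proj₁; proj₂)
open import Data.Sum using (_⊎_)
open import Data.Vec using (Vec; []; _∷_; _[_]≔_)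
import Data.Vec as Vec
open import Data.Vec.Properties using (≡-dec)
open import Function using (_∘_)
open import Function.Bundles using (_↔_; module Inverse)
open import Function.Properties.Inverse using (↔-sym; ↔⇒↣)
open import Level using (0ℓ)
open import Relation.Binary using (Rel; IsTotalOrder; DecidableEquality)
open import Relation.Binary.PropositionalEquality using (_≡_; refl)
open import Relation.Nullary using (¬_; Dec; yes; no)
open import Relation.Nullary.Decidable using (via-injection)
open import Relation.Unary using (Pred; Satisfiable)

------------------------------------------------------------------------
-- Real numbers, axiomatically

-- Classically, the real numbers are the Dedekind-complete ordered field,
-- unique up to isomorphism.  Equality is a setoid equality, so that
-- quotients are not needed for models.  The value of 0# ⁻¹ is unspecified.
record CompleteOrderedField : Set₁ where
  infix  8 _⁻¹
  infix  4 _≤_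
  field
    commutativeRing : CommutativeRing 0ℓ 0ℓ

  open CommutativeRing commutativeRing public

  field
    _≤_          : Rel Carrier 0ℓ
    isTotalOrder : IsTotalOrder _≈_ _≤_
    _⁻¹          : Carrier → Carrier
    0≉1          : ¬ 0# ≈ 1#
    *-inverseʳ   : ∀ x → ¬ x ≈ 0# → x * x ⁻¹ ≈ 1#
    +-monoˡ-≤    : ∀ z {x y} → x ≤ y → x + z ≤ y + z
    *-nonNeg     : ∀ {x y} → 0# ≤ x → 0# ≤ y → 0# ≤ x * y

  UpperBound : Pred Carrier 0ℓ → Pred Carrier 0ℓ
  UpperBound S u = ∀ x → S x → x ≤ u

  field
    supremum : (S : Pred Carrier 0ℓ) → Satisfiable S → Satisfiable (UpperBound S) →
               ∃[ u ] UpperBound S u × (∀ v → UpperBound S v → u ≤ v)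

  infix 4 _∈[0,1]
  _∈[0,1] : Pred Carrier 0ℓ
  x ∈[0,1] = 0# ≤ x × x ≤ 1#

------------------------------------------------------------------------
-- Vocabularies and finite structures

-- The listed symbols are those other than =.
record Vocabulary : Set where
  field
    #symbols : ℕ
    arity    : Fin #symbols → ℕ

data Symbol (τ : Vocabulary) : Set where
  equality : Symbol τ
  symbol   : Fin (Vocabulary.#symbols τ) → Symbol τ

ar : ∀ {τ} → Symbol τ → ℕ
ar     equality   = 2
ar {τ} (symbol R) = Vocabulary.arity τ R

-- As usual in model theory, universes are nonempty.
record Structure (τ : Vocabulary) : Set₁ where
  field
    A           : Set
    size-1      : ℕ
    enumeration : Fin (suc size-1) ↔ A
    interpret   : (R : Fin (Vocabulary.#symbols τ)) → Pred (Vec A (Vocabulary.arity τ R)) 0ℓ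

  infix 4 _≟_ _≟*_
  _≟_ : DecidableEquality A
  _≟_ = via-injection (↔⇒↣ (↔-sym enumeration)) Fin._≟_

  _≟*_ : ∀ {m} → DecidableEquality (Vec A m)
  _≟*_ = ≡-dec _≟_

  element : Fin (suc size-1) → A
  element = Inverse.to enumeration

  elements : List A
  elements = List.tabulate element

  ⟦_⟧ : (R : Symbol τ) → Pred (Vec A (ar R)) 0ℓ
  ⟦ equality ⟧ (a ∷ b ∷ []) = a ≡ b
  ⟦ symbol R ⟧ ā            = interpret R ā

module FiniteSums (ℝ : CompleteOrderedField) {τ : Vocabulary} (𝒜 : Structure τ) where
  open CompleteOrderedField ℝ
  open Structure 𝒜

  sumA : (A → Carrier) → Carrier
  sumA g = MonoidSum.sum +-commutativeMonoid (g ∘ element)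

  sumVec : ∀ m → (Vec A m → Carrier) → Carrier
  sumVec zero    g = g []
  sumVec (suc m) g = sumA λ a → sumVec m λ ā → g (a ∷ ā)

  -- the value x if the condition holds, and 0 otherwise
  infix 5 _when_
  _when_ : {P : Set} → Carrier → Dec P → Carrier
  x when yes _ = x
  x when no  _ = 0#

  IsDistributionOnA : Pred (A → Carrier) 0ℓ
  IsDistributionOnA p = (∀ a → p a ∈[0,1]) × sumA p ≈ 1#

  IsDistribution : ∀ {m} → Pred (Vec A m → Carrier) 0ℓ
  IsDistribution p = (∀ ā → p ā ∈[0,1]) × sumVec _ p ≈ 1#

------------------------------------------------------------------------
-- Variables and domains

Var : Set
Var = ℕ

open DecMembership ℕ._≟_ using (_∈?_)

-- A finite set of variables, listed (without repetitions) in some order.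
Domain : Set
Domain = List Var

insert : (D : Domain) (x : Var) → Dec (x ∈ D) → Domain
insert D x (yes _) = D
insert D x (no  _) = x ∷ D

-- D ∪ {x}
infixl 6 _∪[_]
_∪[_] : Domain → Var → Domain
D ∪[ x ] = insert D x (x ∈? D)

x∈D∪[x] : ∀ D x → x ∈ D ∪[ x ]
x∈D∪[x] D x with x ∈? D
... | yes x∈D = x∈D
... | no  _   = here refl

-- Tuples of variables from D
Tuple : Domain → ℕ → Set
Tuple D m = Vec (∃[ x ] x ∈ D) m

------------------------------------------------------------------------
-- FO(⊥⊥c,∼)

-- Formulas whose free variables are among D
infix 4 _⫫[_]_
data FO⫫∼ (τ : Vocabulary) : Domain → Set where
  rel    : ∀ {D} (R : Symbol τ) → Tuple D (ar R) → FO⫫∼ τ D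
  ¬rel   : ∀ {D} (R : Symbol τ) → Tuple D (ar R) → FO⫫∼ τ D
  -- ȳ ⫫[ x̄ ] z̄ : ȳ and z̄ are independent given x̄
  _⫫[_]_ : ∀ {D l m n} → Tuple D m → Tuple D l → Tuple D n → FO⫫∼ τ D
  ∼_     : ∀ {D} → FO⫫∼ τ D → FO⫫∼ τ D
  _∧_    : ∀ {D} → FO⫫∼ τ D → FO⫫∼ τ D → FO⫫∼ τ D
  _∨_    : ∀ {D} → FO⫫∼ τ D → FO⫫∼ τ D → FO⫫∼ τ D
  ex     : ∀ {D} (x : Var) → FO⫫∼ τ (D ∪[ x ]) → FO⫫∼ τ D
  all    : ∀ {D} (x : Var) → FO⫫∼ τ (D ∪[ x ]) → FO⫫∼ τ D

module TeamSemantics (ℝ : CompleteOrderedField) {τ : Vocabulary} (𝒜 : Structure τ) where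
  open CompleteOrderedField ℝ
  open Structure 𝒜
  open FiniteSums ℝ 𝒜

  -- An assignment over D, stored as its tuple of values in the order of D
  Assignment : Domain → Set
  Assignment D = Vec A (length D)

  _≟ᵃ_ : ∀ {D} → DecidableEquality (Assignment D)
  _≟ᵃ_ = _≟*_

  _∈ᵃ?_ : ∀ {D} (s : Assignment D) (X : List (Assignment D)) → Dec (s ∈ X)
  _∈ᵃ?_ {D} = DecMembership._∈?_ (_≟ᵃ_ {D})

  value : ∀ {D} → Assignment D → ∃[ x ] x ∈ D → A
  value s (_ , x∈D) = Vec.lookup s (index x∈D)

  values : ∀ {D m} → Assignment D → Tuple D m → Vec A m
  values {D} s x̄ = Vec.map (value {D} s) x̄

  update : ∀ {D} → Assignment D → A → (x : Var) (d : Dec (x ∈ D)) → Assignment (insert D x d)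
  update s a x (yes x∈D) = s [ index x∈D ]≔ a
  update s a x (no  _)   = a ∷ s

  -- s(a/x)
  _[_/_] : ∀ {D} → Assignment D → A → (x : Var) → Assignment (D ∪[ x ])
  _[_/_] {D} s a x = update {D} s a x (x ∈? D)

  -- A finite set X of assignments with weights.  X may be listed with
  -- repetitions; only the values of weight on X are meaningful.
  record Team (D : Domain) : Set where
    field
      X      : List (Assignment D)
      weight : Assignment D → Carrier

  open Team

  -- The weight function of a team, with missing weights read as 0
  weight₀ : ∀ {D} → Team D → Assignment D → Carrier
  weight₀ {D} 𝕏 s = weight 𝕏 s when _∈ᵃ?_ {D} s (X 𝕏)

  -- Equality of teams as weight functions
  _≋_ : ∀ {D} → Team D → Team D → Set
  𝕏 ≋ 𝕐 = ∀ s → weight₀ 𝕏 s ≈ weight₀ 𝕐 s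

  IsProbabilistic : ∀ {D} → Pred (Team D) 0ℓ
  IsProbabilistic {D} 𝕏 =
    (∀ s → s ∈ X 𝕏 → weight 𝕏 s ∈[0,1]) × sumVec (length D) (weight₀ 𝕏) ≈ 1#

  _∈supp_ : ∀ {D} → Assignment D → Team D → Set
  s ∈supp 𝕏 = s ∈ X 𝕏 × ¬ weight 𝕏 s ≈ 0#

  -- ∣ 𝕏 ∣[ x̄ ≔ ā ] is the total weight of the s ∈ X with s(x̄) = ā.
  ∣_∣[_≔_] : ∀ {D m} → Team D → Tuple D m → Vec A m → Carrier
  ∣_∣[_≔_] {D} 𝕏 x̄ ā =
    sumVec (length D) λ s → weight₀ 𝕏 s when (values {D} s x̄ ≟* ā)

  -- 𝕏(F/x).  Every s in its set of assignments has s = s(a/x) for a = s(x).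
  _[_/ᶠ_] : ∀ {D} → Team D → (Assignment D → A → Carrier) → (x : Var) → Team (D ∪[ x ])
  _[_/ᶠ_] {D} 𝕏 F x = record
    { X      = cartesianProductWith (λ t a → _[_/_] {D} t a x) (X 𝕏) elements
    ; weight = λ s → let a = value {D ∪[ x ]} s (x , x∈D∪[x] D x) in
                     sumVec (length D) λ t →
                       (weight₀ 𝕏 t * F t a) when (_≟ᵃ_ {D ∪[ x ]} (_[_/_] {D} t a x) s)
    }

  uniform : A → Carrier
  uniform _ = (suc size-1 · 1#) ⁻¹
    where open MonoidMult +-monoid renaming (_×_ to _·_)

  -- 𝕏(A/x)
  _[A/_] : ∀ {D} → Team D → (x : Var) → Team (D ∪[ x ])
  𝕏 [A/ x ] = 𝕏 [ (λ _ → uniform) /ᶠ x ]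

  _⊔[_]_ : ∀ {D} → Team D → Carrier → Team D → Team D
  𝕐 ⊔[ k ] ℤ = record
    { X      = X 𝕐 ++ X ℤ
    ; weight = λ s → k * weight₀ 𝕐 s + (1# - k) * weight₀ ℤ s
    }

  infix 4 _⊨_
  _⊨_ : ∀ {D} → Team D → FO⫫∼ τ D → Set
  _⊨_ {D} 𝕏 (rel R x̄)  = ∀ s → s ∈supp 𝕏 → ⟦ R ⟧ (values {D} s x̄)
  _⊨_ {D} 𝕏 (¬rel R x̄) = ∀ s → s ∈supp 𝕏 → ¬ ⟦ R ⟧ (values {D} s x̄)
  -- Assignments of the variables in x̄ȳz̄ are the restrictions of those over D.
  _⊨_ {D} 𝕏 (ȳ ⫫[ x̄ ] z̄) = ∀ (s : Assignment D) →
    ∣ 𝕏 ∣[ x̄y ≔ values {D} s x̄y ] * ∣ 𝕏 ∣[ x̄z ≔ values {D} s x̄z ] ≈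
    ∣ 𝕏 ∣[ x̄yz ≔ values {D} s x̄yz ] * ∣ 𝕏 ∣[ x̄ ≔ values {D} s x̄ ]
    where
    x̄y  = x̄ Vec.++ ȳ
    x̄z  = x̄ Vec.++ z̄
    x̄yz = x̄ Vec.++ ȳ Vec.++ z̄
  𝕏 ⊨ (∼ φ)   = ¬ 𝕏 ⊨ φ
  𝕏 ⊨ (φ ∧ ψ) = 𝕏 ⊨ φ × 𝕏 ⊨ ψ
  _⊨_ {D} 𝕏 (φ ∨ ψ) = Σ[ 𝕐 ∈ Team D ] Σ[ ℤ ∈ Team D ] Σ[ k ∈ Carrier ]
    IsProbabilistic 𝕐 × IsProbabilistic ℤ × k ∈[0,1] ×
    (𝕐 ⊔[ k ] ℤ) ≋ 𝕏 × 𝕐 ⊨ φ × ℤ ⊨ ψ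
  _⊨_ {D} 𝕏 (ex x φ) = Σ[ F ∈ (Assignment D → A → Carrier) ]
    (∀ t → t ∈ X 𝕏 → IsDistributionOnA (F t)) × (𝕏 [ F /ᶠ x ]) ⊨ φ
  𝕏 ⊨ (all x φ) = (𝕏 [A/ x ]) ⊨ φ

  -- f_𝕏.  As an assignment s over v̄ is stored as the tuple s(v̄), this is
  -- 𝕏(s) at s(v̄) for s ∈ X, and 0 elsewhere.
  teamFunction : ∀ {v̄} → Team v̄ → Vec A (length v̄) → Carrier
  teamFunction 𝕏 = weight₀ 𝕏

------------------------------------------------------------------------
-- SO_d[0,1](SUM,×)

-- Γ lists the arities of the function variables in scope (de Bruijn), and
-- n is the number of first-order variables in scope (de Bruijn).
infixl 7 _⊗_
data NumTerm (Γ : List ℕ) (n : ℕ) : Set where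
  app : ∀ {r} → r ∈ Γ → Vec (Fin n) r → NumTerm Γ n
  _⊗_ : NumTerm Γ n → NumTerm Γ n → NumTerm Γ n
  -- SUM over an m-tuple ȳ of variables, which become the first m variables
  SUM : ∀ m → NumTerm Γ (m ℕ.+ n) → NumTerm Γ n

infix 4 _≐_ _≐̸_
data SO (τ : Vocabulary) (Γ : List ℕ) (n : ℕ) : Set where
  _≐_  : NumTerm Γ n → NumTerm Γ n → SO τ Γ n
  _≐̸_  : NumTerm Γ n → NumTerm Γ n → SO τ Γ n
  rel  : (R : Symbol τ) → Vec (Fin n) (ar R) → SO τ Γ n
  ¬rel : (R : Symbol τ) → Vec (Fin n) (ar R) → SO τ Γ n
  _∧_  : SO τ Γ n → SO τ Γ n → SO τ Γ n
  _∨_  : SO τ Γ n → SO τ Γ n → SO τ Γ n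
  ex   : SO τ Γ (suc n) → SO τ Γ n
  all  : SO τ Γ (suc n) → SO τ Γ n
  exF  : (r : ℕ) → SO τ (r ∷ Γ) n → SO τ Γ n
  allF : (r : ℕ) → SO τ (r ∷ Γ) n → SO τ Γ n

OccursIn : ∀ {Γ n} → Fin (length Γ) → NumTerm Γ n → Set
OccursIn f (app g _) = index g ≡ f
OccursIn f (i ⊗ j)   = OccursIn f i ⊎ OccursIn f j
OccursIn f (SUM _ i) = OccursIn f i

-- the function variable at position f has a free occurrence
FreeIn : ∀ {τ Γ n} → Fin (length Γ) → SO τ Γ n → Set
FreeIn f (i ≐ j)    = OccursIn f i ⊎ OccursIn f j
FreeIn f (i ≐̸ j)    = OccursIn f i ⊎ OccursIn f j
FreeIn f (rel _ _)  = ⊥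
FreeIn f (¬rel _ _) = ⊥
FreeIn f (φ ∧ ψ)    = FreeIn f φ ⊎ FreeIn f ψ
FreeIn f (φ ∨ ψ)    = FreeIn f φ ⊎ FreeIn f ψ
FreeIn f (ex φ)     = FreeIn f φ
FreeIn f (all φ)    = FreeIn f φ
FreeIn f (exF _ φ)  = FreeIn (suc f) φ
FreeIn f (allF _ φ) = FreeIn (suc f) φ

module SOSemantics (ℝ : CompleteOrderedField) {τ : Vocabulary} (𝒜 : Structure τ) where
  open CompleteOrderedField ℝ
  open Structure 𝒜
  open FiniteSums ℝ 𝒜

  FunctionEnv : List ℕ → Set
  FunctionEnv = All (λ r → Vec A r → Carrier)

  eval : ∀ {Γ n} → FunctionEnv Γ → Vec A n → NumTerm Γ n → Carrier
  eval ρ s (app f x̄) = All.lookup ρ f (Vec.map (Vec.lookup s) x̄)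
  eval ρ s (i ⊗ j)   = eval ρ s i * eval ρ s j
  eval ρ s (SUM m i) = sumVec m λ b̄ → eval ρ (b̄ Vec.++ s) i

  infix 4 _∣_⊨_
  _∣_⊨_ : ∀ {Γ n} → FunctionEnv Γ → Vec A n → SO τ Γ n → Set
  ρ ∣ s ⊨ (i ≐ j)    = eval ρ s i ≈ eval ρ s j
  ρ ∣ s ⊨ (i ≐̸ j)    = ¬ eval ρ s i ≈ eval ρ s j
  ρ ∣ s ⊨ rel R x̄    = ⟦ R ⟧ (Vec.map (Vec.lookup s) x̄)
  ρ ∣ s ⊨ ¬rel R x̄   = ¬ ⟦ R ⟧ (Vec.map (Vec.lookup s) x̄)
  ρ ∣ s ⊨ (φ ∧ ψ)    = ρ ∣ s ⊨ φ × ρ ∣ s ⊨ ψ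
  ρ ∣ s ⊨ (φ ∨ ψ)    = ρ ∣ s ⊨ φ ⊎ ρ ∣ s ⊨ ψ
  ρ ∣ s ⊨ ex φ       = ∃[ a ] ρ ∣ a ∷ s ⊨ φ
  ρ ∣ s ⊨ all φ      = ∀ a → ρ ∣ a ∷ s ⊨ φ
  ρ ∣ s ⊨ exF r φ    = Σ[ g ∈ (Vec A r → Carrier) ] IsDistribution g × g ∷ ρ ∣ s ⊨ φ
  ρ ∣ s ⊨ allF r φ   = (g : Vec A r → Carrier) → IsDistribution g → g ∷ ρ ∣ s ⊨ φ

  -- (𝒜, f) ⊨ ψ(f)
  _⊨ˢ_ : ∀ {k} → (Vec A k → Carrier) → SO τ (k ∷ []) 0 → Set
  f ⊨ˢ ψ = (f ∷ []) ∣ [] ⊨ ψ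

{-# OPTIONS --safe #-}
-- By induction on φ, the truth of φ in a team is expressed as a property of its
-- weight function f.  A universal quantifier or ∃x φ asserts the existence of the
-- weight function g of the new team: g arises from some F exactly if, for all t,
-- the sum of g(t(a/x)) over a is the sum of f over all assignments that agree
-- with t off x, as F can then be recovered by normalisation; the uniform F is
-- the case in which these g(t(a/x)) are all equal.  The team disjunction asserts
-- that f is a convex combination of two distributions, and ∼ is the classical
-- dual.  A number is shown to be 0 by being idempotent and different from ∑ f = 1.
module Submission where

open import Defs
import Algebra.Properties.Group as GroupProperties
import Algebra.Properties.Monoid.Mult as MonoidMult
import Algebra.Properties.Ring as RingProperties
import Algebra.Properties.Semiring.Sum as SemiringSum
open import Axiom.ExcludedMiddle using (ExcludedMiddle)
open import Data.Fin using (Fin; zero; suc; punchIn; _↑ˡ_; _↑ʳ_)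
open import Data.Fin.Properties using (punchInᵢ≢i)
open import Data.Fin.Subset using (Subset; inside; outside; ⁅_⁆; _∪_) renaming (⊥ to ∅; _∈_ to _∈ₛ_)
open import Data.Fin.Subset.Properties using (x∈⁅x⁆; x∈⁅y⁆⇒x≡y; x∈p∪q⁺; x∈p∪q⁻; ∉⊥)
open import Data.List using (List; []; _∷_; length; cartesianProductWith)
import Data.List as List
import Data.List.Membership.DecPropositional as DecMembership
open import Data.List.Membership.Propositional using (_∈_)
open import Data.List.Membership.Propositional.Properties
  using (∈-tabulate⁺; ∈-cartesianProductWith⁺; ∈-++⁺ˡ; ∈-++⁺ʳ)
open import Data.List.Relation.Unary.All using ([]; _∷_)
import Data.List.Relation.Unary.All as All
open import Data.List.Relation.Unary.Any using (here; there; index)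
open import Data.List.Relation.Unary.Unique.Propositional using (Unique)
open import Data.Nat using (ℕ; zero; suc)
import Data.Nat as ℕ
open import Data.Product using (Σ-syntax; ∃; ∃-syntax; _×_; _,_; proj₁; proj₂)
open import Data.Product.Function.NonDependent.Propositional using (_×-⇔_)
open import Data.Sum using (_⊎_; inj₁; inj₂)
open import Data.Sum.Function.Propositional using (_⊎-⇔_)
open import Data.Vec using (Vec; []; _∷_; _[_]≔_; here; there)
import Data.Vec as Vec
open import Data.Vec.Functional using (removeAt)
open import Data.Vec.Properties
  using (lookup∘update; []≔-lookup; []≔-idempotent; ∷-injectiveˡ; ∷-injectiveʳ; map-∘; map-cong; map-[]≔;
         lookup-++ˡ; lookup-++ʳ; tabulate-∘; tabulate∘lookup; tabulate-cong)
open import Function using (_∘_)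
open import Function.Bundles using (_⇔_; mk⇔; module Equivalence; module Inverse)
open import Level using (0ℓ)
open import Relation.Binary using (IsTotalOrder)
open import Relation.Binary.PropositionalEquality as ≡ using (_≡_)
import Relation.Binary.Reasoning.Setoid as SetoidReasoning
open import Relation.Nullary using (¬_; Dec; yes; no; contradiction)
open import Relation.Nullary.Decidable using (decidable-stable)

open DecMembership ℕ._≟_ using (_∈?_)
open Equivalence using (to; from)

-- The obstacle is the poverty of the target logic: numerical terms have neither + nor constants,
-- quantified functions must be distributions, and negation is confined to atoms. The map F behind
-- ∃x is a family of distributions, not a single one, so the resulting team is quantified instead. A
-- scalar k must appear as a value of some distribution on A; every k in [0,1] does so only if A has
-- a second element, which forces a separate treatment of singletons. The number 1 is available as
-- the total of a distribution, and multiplication by the size of A as a sum over a variable that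
-- does not occur. Excluded middle enters because equality of reals is not decidable: it splits on
-- whether a weight or a total vanishes, and it justifies passing to the dual formula.

-- Ordered field arithmetic

module FieldProperties (ℝ : CompleteOrderedField) where
  open CompleteOrderedField ℝ hiding (zero)
  open IsTotalOrder isTotalOrder using (antisym; total; ≤-respˡ-≈; ≤-respʳ-≈) renaming (trans to ≤-trans)
  open RingProperties ring using (-‿distribˡ-*; -‿distribʳ-*; -‿involutive)
  open SetoidReasoning setoid

  ≤-resp-≈ : ∀ {w x y z} → w ≈ x → y ≈ z → w ≤ y → x ≤ z
  ≤-resp-≈ w≈x y≈z w≤y = ≤-respˡ-≈ w≈x (≤-respʳ-≈ y≈z w≤y)

  +-nonNeg : ∀ {x y} → 0# ≤ x → 0# ≤ y → 0# ≤ x + y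
  +-nonNeg 0≤x 0≤y = ≤-trans 0≤y (≤-resp-≈ (+-identityˡ _) refl (+-monoˡ-≤ _ 0≤x))

  x≤x+y : ∀ {x y} → 0# ≤ y → x ≤ x + y
  x≤x+y 0≤y = ≤-resp-≈ (+-identityˡ _) (+-comm _ _) (+-monoˡ-≤ _ 0≤y)

  x≤y⇒0≤y-x : ∀ {x y} → x ≤ y → 0# ≤ y - x
  x≤y⇒0≤y-x {x} x≤y = ≤-resp-≈ (-‿inverseʳ x) refl (+-monoˡ-≤ (- x) x≤y)

  x≤0⇒0≤-x : ∀ {x} → x ≤ 0# → 0# ≤ - x
  x≤0⇒0≤-x x≤0 = ≤-resp-≈ refl (+-identityˡ _) (x≤y⇒0≤y-x x≤0)

  -- If 1 ≤ 0, then -1 is nonnegative, and so is its square, which is 1.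
  0≤1 : 0# ≤ 1#
  0≤1 with total 0# 1#
  ... | inj₁ 0≤1 = 0≤1
  ... | inj₂ 1≤0 = ≤-resp-≈ refl -1*-1≈1 (*-nonNeg (x≤0⇒0≤-x 1≤0) (x≤0⇒0≤-x 1≤0))
    where
    -1*-1≈1 : - 1# * - 1# ≈ 1#
    -1*-1≈1 = begin
      - 1# * - 1#    ≈⟨ -‿distribˡ-* _ _ ⟨
      - (1# * - 1#)  ≈⟨ -‿cong (*-identityˡ _) ⟩
      - - 1#         ≈⟨ -‿involutive _ ⟩
      1#             ∎

  x-y+y≈x : ∀ x y → x - y + y ≈ x
  x-y+y≈x x y = trans (+-assoc _ _ _) (trans (+-congˡ (-‿inverseˡ y)) (+-identityʳ x))

  -- A nonpositive y would make -1 = x(-y) nonnegative. The axioms for `⁻¹` do not mention the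
  -- order, so the signs of the uniform and of the normalised weights come from here.
  x*y≈1⇒y-nonNeg : ∀ {x y} → 0# ≤ x → x * y ≈ 1# → 0# ≤ y
  x*y≈1⇒y-nonNeg {x} {y} 0≤x xy≈1 with total 0# y
  ... | inj₁ 0≤y = 0≤y
  ... | inj₂ y≤0 = contradiction (antisym 0≤1 1≤0) 0≉1
    where
    0≤-1 : 0# ≤ - 1#
    0≤-1 = ≤-resp-≈ refl (trans (sym (-‿distribʳ-* x y)) (-‿cong xy≈1)) (*-nonNeg 0≤x (x≤0⇒0≤-x y≤0))
    1≤0 : 1# ≤ 0#
    1≤0 = ≤-resp-≈ refl (-‿inverseʳ 1#) (x≤x+y 0≤-1)

  *-cancelˡ-≈ : ∀ {x y z} → ¬ x ≈ 0# → x * y ≈ x * z → y ≈ z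
  *-cancelˡ-≈ {x} {y} {z} x≉0 xy≈xz = begin
    y                  ≈⟨ inverse y ⟩
    x ⁻¹ * (x * y)     ≈⟨ *-congˡ xy≈xz ⟩
    x ⁻¹ * (x * z)     ≈⟨ inverse z ⟨
    z                  ∎
    where
    inverse : ∀ w → w ≈ x ⁻¹ * (x * w)
    inverse w = begin
      w               ≈⟨ *-identityˡ w ⟨
      1# * w          ≈⟨ *-congʳ (trans (*-comm _ _) (*-inverseʳ x x≉0)) ⟨
      x ⁻¹ * x * w    ≈⟨ *-assoc _ _ _ ⟩
      x ⁻¹ * (x * w)  ∎

-- Finite sums over A and over tuples

module SumProperties (ℝ : CompleteOrderedField) {τ : Vocabulary} (𝒜 : Structure τ) where
  open CompleteOrderedField ℝ hiding (zero)
  open IsTotalOrder isTotalOrder using () renaming (refl to ≤-refl; trans to ≤-trans)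
  open FieldProperties ℝ
  open Structure 𝒜
  open FiniteSums ℝ 𝒜
  open MonoidMult +-monoid using () renaming (_×_ to _·_)
  open SemiringSum semiring
    using (sum; sum-cong-≋; sum-remove; ∑-distrib-+; ∑-comm; *-distribˡ-sum; sum-replicate; sum-replicate-zero)
  open SetoidReasoning setoid

  sumA-cong : ∀ {g h} → (∀ a → g a ≈ h a) → sumA g ≈ sumA h
  sumA-cong g≈h = sum-cong-≋ (g≈h ∘ element)

  sumA-distrib-+ : ∀ g h → sumA (λ a → g a + h a) ≈ sumA g + sumA h
  sumA-distrib-+ g h = ∑-distrib-+ (g ∘ element) (h ∘ element)

  *-distribˡ-sumA : ∀ x g → x * sumA g ≈ sumA (λ a → x * g a)
  *-distribˡ-sumA x g = *-distribˡ-sum x (g ∘ element)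

  *-distribʳ-sumA : ∀ x g → sumA g * x ≈ sumA (λ a → g a * x)
  *-distribʳ-sumA x g =
    trans (*-comm _ _) (trans (*-distribˡ-sumA x g) (sumA-cong λ a → *-comm x (g a)))

  sumA-comm : (g : A → A → Carrier) → sumA (λ a → sumA λ b → g a b) ≈ sumA (λ b → sumA λ a → g a b)
  sumA-comm g = ∑-comm {suc size-1} {suc size-1} λ i j → g (element i) (element j)

  sumA-const : ∀ x → sumA (λ _ → x) ≈ suc size-1 · 1# * x
  sumA-const x = begin
    sumA (λ _ → x)          ≈⟨ sumA-cong (λ _ → *-identityˡ x) ⟨
    sumA (λ _ → 1# * x)     ≈⟨ *-distribʳ-sumA x (λ _ → 1#) ⟨
    sumA (λ _ → 1#) * x     ≈⟨ *-congʳ (sum-replicate (suc size-1)) ⟩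
    suc size-1 · 1# * x     ∎

  sumA-0 : ∀ {g} → (∀ a → g a ≈ 0#) → sumA g ≈ 0#
  sumA-0 g≈0 = trans (sumA-cong g≈0) (sum-replicate-zero (suc size-1))

  sum-nonNeg : ∀ {n} (g : Fin n → Carrier) → (∀ i → 0# ≤ g i) → 0# ≤ sum g
  sum-nonNeg {zero}  g 0≤g = ≤-refl
  sum-nonNeg {suc n} g 0≤g = +-nonNeg (0≤g zero) (sum-nonNeg (g ∘ suc) (0≤g ∘ suc))

  sumA-nonNeg : ∀ {g} → (∀ a → 0# ≤ g a) → 0# ≤ sumA g
  sumA-nonNeg {g} 0≤g = sum-nonNeg (g ∘ element) (0≤g ∘ element)

  index-of : A → Fin (suc size-1)
  index-of = Inverse.from enumeration

  element-index-of : ∀ a → element (index-of a) ≡ a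
  element-index-of = Inverse.strictlyInverseˡ enumeration

  index-of-element : ∀ i → index-of (element i) ≡ i
  index-of-element = Inverse.strictlyInverseʳ enumeration

  sumA-remove : ∀ g a → sumA g ≈ g a + sum (removeAt (g ∘ element) (index-of a))
  sumA-remove g a = ≡.subst (λ b → sumA g ≈ g b + sum (removeAt (g ∘ element) (index-of a)))
    (element-index-of a) (sum-remove {i = index-of a} (g ∘ element))

  ≤-sumA : ∀ {g} → (∀ a → 0# ≤ g a) → ∀ a → g a ≤ sumA g
  ≤-sumA {g} 0≤g a = ≤-resp-≈ refl (sym (sumA-remove g a))
    (x≤x+y (sum-nonNeg (removeAt (g ∘ element) (index-of a)) λ _ → 0≤g _))

  sumA-only : ∀ {g} a → (∀ b → ¬ b ≡ a → g b ≈ 0#) → sumA g ≈ g a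
  sumA-only {g} a g≈0 = begin
    sumA g                                                    ≈⟨ sumA-remove g a ⟩
    g a + sum (removeAt (g ∘ element) (index-of a))           ≈⟨ +-congˡ (sum-cong-≋ λ j → g≈0 _ (skips j)) ⟩
    g a + sum {n = size-1} (λ _ → 0#)                         ≈⟨ +-congˡ (sum-replicate-zero size-1) ⟩
    g a + 0#                                                  ≈⟨ +-identityʳ _ ⟩
    g a                                                       ∎
    where
    skips : ∀ j → ¬ element (punchIn (index-of a) j) ≡ a
    skips j e = punchInᵢ≢i (index-of a) j
      (≡.trans (≡.sym (index-of-element _)) (≡.cong index-of e))

  sumVec-cong : ∀ m {g h} → (∀ s → g s ≈ h s) → sumVec m g ≈ sumVec m h
  sumVec-cong zero    g≈h = g≈h []
  sumVec-cong (suc m) {g} {h} g≈h =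
    sumA-cong λ a → sumVec-cong m {g ∘ (a ∷_)} {h ∘ (a ∷_)} λ s → g≈h (a ∷ s)

  sumA-sumVec-comm : ∀ m (g : A → Vec A m → Carrier) →
     sumA (λ a → sumVec m (g a)) ≈ sumVec m (λ s → sumA λ a → g a s)
  sumA-sumVec-comm zero    g = refl
  sumA-sumVec-comm (suc m) g =
    trans (sumA-comm λ a b → sumVec m λ s → g a (b ∷ s))
      (sumA-cong λ b → sumA-sumVec-comm m λ a s → g a (b ∷ s))

  sumVec-comm : ∀ m n (g : Vec A m → Vec A n → Carrier) →
     sumVec m (λ s → sumVec n (g s)) ≈ sumVec n (λ t → sumVec m λ s → g s t)
  sumVec-comm zero    n g = refl
  sumVec-comm (suc m) n g =
    trans (sumA-cong λ a → sumVec-comm m n (g ∘ (a ∷_))) (sumA-sumVec-comm n λ a t → sumVec m λ s → g (a ∷ s) t)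

  sumVec-0 : ∀ m {g} → (∀ s → g s ≈ 0#) → sumVec m g ≈ 0#
  sumVec-0 zero    g≈0 = g≈0 []
  sumVec-0 (suc m) {g} g≈0 = sumA-0 λ a → sumVec-0 m {g ∘ (a ∷_)} λ s → g≈0 (a ∷ s)

  sumVec-nonNeg : ∀ m {g} → (∀ s → 0# ≤ g s) → 0# ≤ sumVec m g
  sumVec-nonNeg zero    0≤g = 0≤g []
  sumVec-nonNeg (suc m) {g} 0≤g = sumA-nonNeg λ a → sumVec-nonNeg m {g ∘ (a ∷_)} λ s → 0≤g (a ∷ s)

  ≤-sumVec : ∀ m {g} → (∀ s → 0# ≤ g s) → ∀ s → g s ≤ sumVec m g
  ≤-sumVec zero    0≤g []      = ≤-refl
  ≤-sumVec (suc m) {g} 0≤g (a ∷ s) =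
    ≤-trans (≤-sumVec m {g ∘ (a ∷_)} (λ t → 0≤g (a ∷ t)) s)
      (≤-sumA (λ b → sumVec-nonNeg m {g ∘ (b ∷_)} λ t → 0≤g (b ∷ t)) a)

  sumVec-only : ∀ m {g} s → (∀ t → ¬ t ≡ s → g t ≈ 0#) → sumVec m g ≈ g s
  sumVec-only zero    []      g≈0 = refl
  sumVec-only (suc m) {g} (a ∷ s) g≈0 = trans
    (sumA-only {λ b → sumVec m (g ∘ (b ∷_))} a λ b b≢a →
      sumVec-0 m {g ∘ (b ∷_)} λ t → g≈0 (b ∷ t) λ { ≡.refl → b≢a ≡.refl })
    (sumVec-only m {g ∘ (a ∷_)} s λ t t≢s → g≈0 (a ∷ t) λ { ≡.refl → t≢s ≡.refl })

  when-yes : ∀ {P : Set} {x} (P? : Dec P) → P → (x when P?) ≈ x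
  when-yes (yes _) p = refl
  when-yes (no ¬p) p = contradiction p ¬p

  when-no : ∀ {P : Set} {x} (P? : Dec P) → ¬ P → (x when P?) ≈ 0#
  when-no (yes p) ¬p = contradiction p ¬p
  when-no (no _)  ¬p = refl

  -- The value of `_when_` depends on the truth of the condition and not on how it was decided, so a
  -- decision by excluded middle can be exchanged for a computed one.
  when-⇔ : ∀ {P Q : Set} {x y} (P? : Dec P) (Q? : Dec Q) → (P → Q) → (Q → P) → x ≈ y →
           (x when P?) ≈ (y when Q?)
  when-⇔ (yes p) Q? p⇒q q⇒p x≈y = trans x≈y (sym (when-yes Q? (p⇒q p)))
  when-⇔ (no ¬p) Q? p⇒q q⇒p x≈y = sym (when-no Q? (¬p ∘ q⇒p))

  when-nonNeg : ∀ {P : Set} {x} (P? : Dec P) → 0# ≤ x → 0# ≤ (x when P?)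
  when-nonNeg (yes _) 0≤x = 0≤x
  when-nonNeg (no _)  0≤x = ≤-refl

  -- The upper bound 1 is automatic: a nonnegative summand is at most the total.
  distributionOnA : ∀ {p} → (∀ a → 0# ≤ p a) → sumA p ≈ 1# → IsDistributionOnA p
  distributionOnA 0≤p ∑p≈1 = (λ a → 0≤p a , ≤-resp-≈ refl ∑p≈1 (≤-sumA 0≤p a)) , ∑p≈1

  distribution : ∀ {m p} → (∀ s → 0# ≤ p s) → sumVec m p ≈ 1# → IsDistribution p
  distribution {m} 0≤p ∑p≈1 = (λ s → 0≤p s , ≤-resp-≈ refl ∑p≈1 (≤-sumVec m 0≤p s)) , ∑p≈1

-- Weight functions of teams

module TeamProperties (ℝ : CompleteOrderedField) {τ : Vocabulary} (𝒜 : Structure τ) where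
  open CompleteOrderedField ℝ hiding (zero)
  open IsTotalOrder isTotalOrder using () renaming (refl to ≤-refl; reflexive to ≤-reflexive)
  open FieldProperties ℝ
  open Structure 𝒜
  open FiniteSums ℝ 𝒜
  open SumProperties ℝ 𝒜
  open TeamSemantics ℝ 𝒜
  open Team
  open SetoidReasoning setoid

  module _ {D : Domain} (𝕏 : Team D) where

    weight₀-∈ : ∀ {s} → s ∈ X 𝕏 → weight₀ 𝕏 s ≈ weight 𝕏 s
    weight₀-∈ {s} = when-yes (_∈ᵃ?_ {D} s (X 𝕏))

    weight₀-∉ : ∀ {s} → ¬ s ∈ X 𝕏 → weight₀ 𝕏 s ≈ 0#
    weight₀-∉ {s} = when-no (_∈ᵃ?_ {D} s (X 𝕏))

    ∈supp⇒weight₀≉0 : ∀ {s} → _∈supp_ {D} s 𝕏 → ¬ weight₀ 𝕏 s ≈ 0#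
    ∈supp⇒weight₀≉0 (s∈X , w≉0) w₀≈0 = w≉0 (trans (sym (weight₀-∈ s∈X)) w₀≈0)

    weight₀≉0⇒∈supp : ∀ {s} → ¬ weight₀ 𝕏 s ≈ 0# → _∈supp_ {D} s 𝕏
    weight₀≉0⇒∈supp {s} w₀≉0 with _∈ᵃ?_ {D} s (X 𝕏)
    ... | yes s∈X = s∈X , w₀≉0
    ... | no  s∉X = contradiction refl w₀≉0

    weight₀-nonNeg : IsProbabilistic 𝕏 → ∀ s → 0# ≤ weight₀ 𝕏 s
    weight₀-nonNeg (w∈[0,1] , _) s with _∈ᵃ?_ {D} s (X 𝕏)
    ... | yes s∈X = proj₁ (w∈[0,1] s s∈X)
    ... | no  _   = ≤-refl

    weight₀-distribution : IsProbabilistic 𝕏 → IsDistribution {length D} (weight₀ 𝕏)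
    weight₀-distribution prob = distribution (weight₀-nonNeg prob) (proj₂ prob)

    probabilistic : IsDistribution {length D} (weight₀ 𝕏) → IsProbabilistic 𝕏
    probabilistic (w₀∈[0,1] , ∑w₀≈1) =
      (λ s s∈X → ≤-resp-≈ refl (weight₀-∈ s∈X) (proj₁ (w₀∈[0,1] s)) ,
                 ≤-resp-≈ (weight₀-∈ s∈X) refl (proj₂ (w₀∈[0,1] s))) , ∑w₀≈1

  IsDistribution-resp-≈ : ∀ {m g h} → (∀ s → g s ≈ h s) → IsDistribution {m} g → IsDistribution {m} h
  IsDistribution-resp-≈ {m} g≈h (g∈[0,1] , ∑g≈1) =
    (λ s → ≤-resp-≈ refl (g≈h s) (proj₁ (g∈[0,1] s)) , ≤-resp-≈ (g≈h s) refl (proj₂ (g∈[0,1] s))) ,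
    trans (sym (sumVec-cong m g≈h)) ∑g≈1

  element∈elements : ∀ a → a ∈ elements
  element∈elements a = ≡.subst (_∈ elements) (element-index-of a) (∈-tabulate⁺ {f = element} (index-of a))

  tuples : ∀ m → List (Vec A m)
  tuples zero    = [] ∷ []
  tuples (suc m) = cartesianProductWith _∷_ elements (tuples m)

  ∈tuples : ∀ {m} (s : Vec A m) → s ∈ tuples m
  ∈tuples []      = here ≡.refl
  ∈tuples (a ∷ s) = ∈-cartesianProductWith⁺ _∷_ (element∈elements a) (∈tuples s)

  -- Zero weights are allowed, so listing every tuple turns any distribution into a team. This
  -- supplies the two teams of a disjunction from quantified functions.
  fullTeam : ∀ D → (Assignment D → Carrier) → Team D
  fullTeam D g = record { X = tuples (length D) ; weight = g }

  weight₀-fullTeam : ∀ D g s → weight₀ (fullTeam D g) s ≈ g s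
  weight₀-fullTeam D g s = weight₀-∈ (fullTeam D g) (∈tuples s)

  fullTeam-probabilistic : ∀ D {g} → IsDistribution g → IsProbabilistic (fullTeam D g)
  fullTeam-probabilistic D {g} dist =
    probabilistic (fullTeam D g) (IsDistribution-resp-≈ (sym ∘ weight₀-fullTeam D g) dist)

  weight₀-⊔ : ∀ {D} (𝕐 ℤ : Team D) k s →
    weight₀ (𝕐 ⊔[ k ] ℤ) s ≈ k * weight₀ 𝕐 s + (1# - k) * weight₀ ℤ s
  weight₀-⊔ {D} 𝕐 ℤ k s with _∈ᵃ?_ {D} s (X 𝕐 List.++ X ℤ)
  ... | yes _ = refl
  ... | no s∉ = sym (begin
    k * weight₀ 𝕐 s + (1# - k) * weight₀ ℤ s
      ≈⟨ +-cong (*-congˡ (weight₀-∉ 𝕐 (s∉ ∘ ∈-++⁺ˡ))) (*-congˡ (weight₀-∉ ℤ (s∉ ∘ ∈-++⁺ʳ (X 𝕐)))) ⟩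
    k * 0# + (1# - k) * 0#
      ≈⟨ +-cong (zeroʳ _) (zeroʳ _) ⟩
    0# + 0#
      ≈⟨ +-identityˡ 0# ⟩
    0# ∎)

  value-update : ∀ D x (t : Assignment D) a →
    value {D ∪[ x ]} (_[_/_] {D} t a x) (x , x∈D∪[x] D x) ≡ a
  value-update D x t a with x ∈? D
  ... | yes x∈D = lookup∘update (index x∈D) t a
  ... | no  _   = ≡.refl

  -- For x in D, s itself serves as t; otherwise its tail does. Hence identities between weights
  -- over D ∪ {x} need checking only at assignments of the form t(a/x).
  update-value : ∀ D x (s : Assignment (D ∪[ x ])) →
    ∃ λ t → _[_/_] {D} t (value {D ∪[ x ]} s (x , x∈D∪[x] D x)) x ≡ s
  update-value D x s       with x ∈? D
  update-value D x s       | yes x∈D = s , []≔-lookup s (index x∈D)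
  update-value D x (a ∷ t) | no  _   = t , ≡.refl

  -- The sum of h over the assignments that agree with t except possibly at x
  sumOver : ∀ D x → Dec (x ∈ D) → (Assignment D → Carrier) → Assignment D → Carrier
  sumOver D x (yes x∈D) h t = sumA λ b → h (t [ index x∈D ]≔ b)
  sumOver D x (no  _)   h t = h t

  -- The t′ that coincide with t once position i is overwritten are the `t [ i ]≔ b`, exactly one
  -- for each b, whatever value a is written there.
  sumVec-agree : ∀ {m} (i : Fin m) a (t : Vec A m) (h : Vec A m → Carrier) →
    sumVec m (λ t′ → h t′ when (t′ [ i ]≔ a ≟* t [ i ]≔ a)) ≈ sumA λ b → h (t [ i ]≔ b)
  sumVec-agree {suc m} zero a (_ ∷ t) h = sumA-cong λ b →
    trans (sumVec-only m {λ t′ → h (b ∷ t′) when (a ∷ t′ ≟* a ∷ t)} t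
            λ t′ t′≢t → when-no (a ∷ t′ ≟* a ∷ t) (t′≢t ∘ ∷-injectiveʳ))
          (when-yes (a ∷ t ≟* a ∷ t) ≡.refl)
  sumVec-agree {suc m} (suc i) a (c ∷ t) h = begin
    sumA (λ b → sumVec m λ t′ → h (b ∷ t′) when (b ∷ t′ [ i ]≔ a ≟* c ∷ t [ i ]≔ a))
      ≈⟨ sumA-only {λ b → sumVec m λ t′ → h (b ∷ t′) when (b ∷ t′ [ i ]≔ a ≟* c ∷ t [ i ]≔ a)} c
           (λ b b≢c → sumVec-0 m λ t′ →
             when-no (b ∷ t′ [ i ]≔ a ≟* c ∷ t [ i ]≔ a) (b≢c ∘ ∷-injectiveˡ)) ⟩
    sumVec m (λ t′ → h (c ∷ t′) when (c ∷ t′ [ i ]≔ a ≟* c ∷ t [ i ]≔ a))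
      ≈⟨ sumVec-cong m (λ t′ → when-⇔ (c ∷ t′ [ i ]≔ a ≟* c ∷ t [ i ]≔ a) (t′ [ i ]≔ a ≟* t [ i ]≔ a)
           ∷-injectiveʳ (≡.cong (c ∷_)) refl) ⟩
    sumVec m (λ t′ → h (c ∷ t′) when (t′ [ i ]≔ a ≟* t [ i ]≔ a))
      ≈⟨ sumVec-agree i a t (h ∘ (c ∷_)) ⟩
    sumA (λ b → h (c ∷ t [ i ]≔ b)) ∎

  sumVec-update : ∀ D x d a t (h : Assignment D → Carrier) →
    sumVec (length D) (λ t′ → h t′ when (_≟ᵃ_ {insert D x d} (update {D} t′ a x d) (update {D} t a x d))) ≈
    sumOver D x d h t
  sumVec-update D x (yes x∈D) a t h = sumVec-agree (index x∈D) a t h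
  sumVec-update D x (no  _)   a t h =
    trans (sumVec-only (length D) {λ t′ → h t′ when (a ∷ t′ ≟* a ∷ t)} t
            λ t′ t′≢t → when-no (a ∷ t′ ≟* a ∷ t) (t′≢t ∘ ∷-injectiveʳ))
          (when-yes (a ∷ t ≟* a ∷ t) ≡.refl)

  -- A choice of one element from each class of assignments that agree except
  -- possibly at x; it plays the role of a quotient map.
  representative : ∀ D x → Dec (x ∈ D) → Assignment D → Assignment D
  representative D x (yes x∈D) t = t [ index x∈D ]≔ element zero
  representative D x (no  _)   t = t

  update-representative : ∀ D x d t a → update {D} (representative D x d t) a x d ≡ update {D} t a x d
  update-representative D x (yes x∈D) t a = []≔-idempotent t (index x∈D)
  update-representative D x (no  _)   t a = ≡.refl

  sumOver-cong : ∀ D x d {h h′} t →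
    (∀ t′ → representative D x d t′ ≡ representative D x d t → h t′ ≈ h′ t′) →
    sumOver D x d h t ≈ sumOver D x d h′ t
  sumOver-cong D x (yes x∈D) t h≈h′ = sumA-cong λ b → h≈h′ (t [ index x∈D ]≔ b) ([]≔-idempotent t (index x∈D))
  sumOver-cong D x (no  _)   t h≈h′ = h≈h′ t ≡.refl

  sumA-sumOver-comm : ∀ D x d (h : A → Assignment D → Carrier) t →
    sumA (λ a → sumOver D x d (h a) t) ≈ sumOver D x d (λ t′ → sumA λ a → h a t′) t
  sumA-sumOver-comm D x (yes x∈D) h t = sumA-comm λ a b → h a (t [ index x∈D ]≔ b)
  sumA-sumOver-comm D x (no  _)   h t = refl

  *-distribʳ-sumOver : ∀ D x d c h t → sumOver D x d h t * c ≈ sumOver D x d (λ t′ → h t′ * c) t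
  *-distribʳ-sumOver D x (yes x∈D) c h t = *-distribʳ-sumA c λ b → h (t [ index x∈D ]≔ b)
  *-distribʳ-sumOver D x (no  _)   c h t = refl

  -- Weights after supplementation by F

  module _ {D : Domain} (𝕏 : Team D) (F : Assignment D → A → Carrier) (x : Var) where
    private
      infix 8 _⟨_⟩
      infix 4 _≟ˣ_

      w = weight₀ 𝕏

      _⟨_⟩ : Assignment D → A → Assignment (D ∪[ x ])
      t ⟨ a ⟩ = _[_/_] {D} t a x

      _≟ˣ_ : (s t : Assignment (D ∪[ x ])) → Dec (s ≡ t)
      _≟ˣ_ = _≟ᵃ_ {D ∪[ x ]}

    -- Letting a range over A, where the definition fixes it as s(x), makes the summation range
    -- independent of s, so that sums can be interchanged. Nothing is added: t(a/x) = s forces a =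
    -- s(x). Nor is anything lost outside the listed assignments: there t(a/x) = s implies that t is
    -- not in X.
    weight₀-[/ᶠ] : ∀ s → weight₀ (𝕏 [ F /ᶠ x ]) s ≈
      sumVec (length D) λ t → sumA λ a → w t * F t a when (t ⟨ a ⟩ ≟ˣ s)
    weight₀-[/ᶠ] s with _∈ᵃ?_ {D ∪[ x ]} s (X (𝕏 [ F /ᶠ x ]))
    ... | yes _ = sumVec-cong (length D) λ t → sym
      (sumA-only {λ a → w t * F t a when (t ⟨ a ⟩ ≟ˣ s)} (value {D ∪[ x ]} s (x , x∈D∪[x] D x)) λ b b≢ →
        when-no (t ⟨ b ⟩ ≟ˣ s) λ e → b≢
          (≡.trans (≡.sym (value-update D x t b)) (≡.cong (λ s → value {D ∪[ x ]} s (x , x∈D∪[x] D x)) e)))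
    ... | no s∉ = sym (sumVec-0 (length D) λ t → sumA-0 λ a → vanishes t a)
      where
      vanishes : ∀ t a → (w t * F t a when (t ⟨ a ⟩ ≟ˣ s)) ≈ 0#
      vanishes t a with t ⟨ a ⟩ ≟ˣ s
      ... | no  _      = refl
      ... | yes ≡.refl = trans (*-congʳ (weight₀-∉ 𝕏 λ t∈X →
        s∉ (∈-cartesianProductWith⁺ (λ t a → t ⟨ a ⟩) t∈X (element∈elements a)))) (zeroˡ _)

    weight₀-[/ᶠ]-update : ∀ t a →
      weight₀ (𝕏 [ F /ᶠ x ]) (t ⟨ a ⟩) ≈ sumOver D x (x ∈? D) (λ t′ → w t′ * F t′ a) t
    weight₀-[/ᶠ]-update t a = begin
      weight₀ (𝕏 [ F /ᶠ x ]) (t ⟨ a ⟩)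
        ≈⟨ weight₀-[/ᶠ] (t ⟨ a ⟩) ⟩
      sumVec (length D) (λ t′ → sumA λ b → w t′ * F t′ b when (t′ ⟨ b ⟩ ≟ˣ t ⟨ a ⟩))
        ≈⟨ sumVec-cong (length D) (λ t′ →
             sumA-only {λ b → w t′ * F t′ b when (t′ ⟨ b ⟩ ≟ˣ t ⟨ a ⟩)} a λ b b≢a →
               when-no (t′ ⟨ b ⟩ ≟ˣ t ⟨ a ⟩) λ e → b≢a (same-value e)) ⟩
      sumVec (length D) (λ t′ → w t′ * F t′ a when (t′ ⟨ a ⟩ ≟ˣ t ⟨ a ⟩))
        ≈⟨ sumVec-update D x (x ∈? D) a t (λ t′ → w t′ * F t′ a) ⟩
      sumOver D x (x ∈? D) (λ t′ → w t′ * F t′ a) t ∎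
      where
      same-value : ∀ {t′ b} → t′ ⟨ b ⟩ ≡ t ⟨ a ⟩ → b ≡ a
      same-value {t′} {b} e = ≡.trans (≡.sym (value-update D x t′ b))
        (≡.trans (≡.cong (λ s → value {D ∪[ x ]} s (x , x∈D∪[x] D x)) e) (value-update D x t a))

    module _ (F-dist : ∀ t → t ∈ X 𝕏 → IsDistributionOnA (F t)) where

      -- F is constrained on X only; elsewhere the weight 0 hides its values.
      weight₀*F-sum : ∀ t → sumA (λ a → w t * F t a) ≈ w t
      weight₀*F-sum t with _∈ᵃ?_ {D} t (X 𝕏)
      ... | yes t∈X = trans (sym (*-distribˡ-sumA _ (F t)))
                            (trans (*-congˡ (proj₂ (F-dist t t∈X))) (*-identityʳ _))
      ... | no  _   = sumA-0 λ a → zeroˡ (F t a)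

      weight₀*F-nonNeg : IsProbabilistic 𝕏 → ∀ t a → 0# ≤ w t * F t a
      weight₀*F-nonNeg (w∈[0,1] , _) t a with _∈ᵃ?_ {D} t (X 𝕏)
      ... | yes t∈X = *-nonNeg (proj₁ (w∈[0,1] t t∈X)) (proj₁ (proj₁ (F-dist t t∈X) a))
      ... | no  _   = ≤-reflexive (sym (zeroˡ (F t a)))

      -- Once the sum over a is moved inside the sum over the class of t, each F t′ sums to 1. This
      -- is the necessity of the condition that characterises the teams 𝕏(F/x).
      [/ᶠ]-sumA : ∀ t → sumA (λ a → weight₀ (𝕏 [ F /ᶠ x ]) (t ⟨ a ⟩)) ≈ sumOver D x (x ∈? D) w t
      [/ᶠ]-sumA t = begin
        sumA (λ a → weight₀ (𝕏 [ F /ᶠ x ]) (t ⟨ a ⟩))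
          ≈⟨ sumA-cong (weight₀-[/ᶠ]-update t) ⟩
        sumA (λ a → sumOver D x (x ∈? D) (λ t′ → w t′ * F t′ a) t)
          ≈⟨ sumA-sumOver-comm D x (x ∈? D) (λ a t′ → w t′ * F t′ a) t ⟩
        sumOver D x (x ∈? D) (λ t′ → sumA λ a → w t′ * F t′ a) t
          ≈⟨ sumOver-cong D x (x ∈? D) t (λ t′ _ → weight₀*F-sum t′) ⟩
        sumOver D x (x ∈? D) w t ∎

      [/ᶠ]-probabilistic : IsProbabilistic 𝕏 → IsProbabilistic (𝕏 [ F /ᶠ x ])
      [/ᶠ]-probabilistic prob = probabilistic (𝕏 [ F /ᶠ x ]) (distribution
        (λ s → ≤-resp-≈ refl (sym (weight₀-[/ᶠ] s)) (sumVec-nonNeg (length D) λ t → sumA-nonNeg λ a →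
          when-nonNeg (t ⟨ a ⟩ ≟ˣ s) (weight₀*F-nonNeg prob t a)))
        ∑w≈1)
        where
        m = length D
        n = length (D ∪[ x ])
        ∑w≈1 : sumVec n (weight₀ (𝕏 [ F /ᶠ x ])) ≈ 1#
        ∑w≈1 = begin
          sumVec n (weight₀ (𝕏 [ F /ᶠ x ]))
            ≈⟨ sumVec-cong n weight₀-[/ᶠ] ⟩
          sumVec n (λ s → sumVec m λ t → sumA λ a → w t * F t a when (t ⟨ a ⟩ ≟ˣ s))
            ≈⟨ sumVec-comm n m (λ s t → sumA λ a → w t * F t a when (t ⟨ a ⟩ ≟ˣ s)) ⟩
          sumVec m (λ t → sumVec n λ s → sumA λ a → w t * F t a when (t ⟨ a ⟩ ≟ˣ s))
            ≈⟨ sumVec-cong m (λ t → sumA-sumVec-comm n λ a s → w t * F t a when (t ⟨ a ⟩ ≟ˣ s)) ⟨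
          sumVec m (λ t → sumA λ a → sumVec n λ s → w t * F t a when (t ⟨ a ⟩ ≟ˣ s))
            -- For fixed t and a, the only s that receives weight is t(a/x).
            ≈⟨ sumVec-cong m (λ t → sumA-cong λ a → trans
                 (sumVec-only n {λ s → w t * F t a when (t ⟨ a ⟩ ≟ˣ s)} (t ⟨ a ⟩)
                   λ s s≢ → when-no (t ⟨ a ⟩ ≟ˣ s) (s≢ ∘ ≡.sym))
                 (when-yes (t ⟨ a ⟩ ≟ˣ t ⟨ a ⟩) ≡.refl)) ⟩
          sumVec m (λ t → sumA λ a → w t * F t a)
            ≈⟨ sumVec-cong m weight₀*F-sum ⟩
          sumVec m w
            ≈⟨ proj₂ prob ⟩
          1# ∎

-- Normalisation and the uniform distribution

module ChoiceProperties
  (em : ExcludedMiddle 0ℓ) (ℝ : CompleteOrderedField) {τ : Vocabulary} (𝒜 : Structure τ) where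
  open CompleteOrderedField ℝ hiding (zero)
  open IsTotalOrder isTotalOrder using (antisym)
  open FieldProperties ℝ
  open Structure 𝒜
  open FiniteSums ℝ 𝒜
  open SumProperties ℝ 𝒜
  open TeamSemantics ℝ 𝒜
  open TeamProperties ℝ 𝒜
  open GroupProperties +-group using () renaming (∙-cancelʳ to +-cancelʳ)
  open MonoidMult +-monoid using () renaming (_×_ to _·_)
  open SetoidReasoning setoid

  pointMass : ∀ a → IsDistributionOnA λ b → 1# when (b ≟ a)
  pointMass a = distributionOnA (λ b → when-nonNeg (b ≟ a) 0≤1)
    (trans (sumA-only a λ b → when-no (b ≟ a)) (when-yes (a ≟ a) ≡.refl))

  -- The point mass is a default value: a nonnegative p with total 0 vanishes, and then any
  -- distribution, multiplied by that total, gives p back.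
  normalise : (A → Carrier) → A → Carrier
  normalise p a with em {sumA p ≈ 0#}
  ... | yes _ = 1# when (a ≟ element zero)
  ... | no  _ = sumA p ⁻¹ * p a

  normalise-distribution : ∀ {p} → (∀ a → 0# ≤ p a) → IsDistributionOnA (normalise p)
  normalise-distribution {p} 0≤p with em {sumA p ≈ 0#}
  ... | yes _   = pointMass (element zero)
  ... | no  ∑≉0 = distributionOnA
    (λ a → *-nonNeg (x*y≈1⇒y-nonNeg (sumA-nonNeg 0≤p) (*-inverseʳ _ ∑≉0)) (0≤p a))
    (trans (sym (*-distribˡ-sumA _ p)) (trans (*-comm _ _) (*-inverseʳ _ ∑≉0)))

  sumA*normalise : ∀ {p} → (∀ a → 0# ≤ p a) → ∀ a → sumA p * normalise p a ≈ p a
  sumA*normalise {p} 0≤p a with em {sumA p ≈ 0#}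
  ... | yes ∑≈0 = trans (*-congʳ ∑≈0) (trans (zeroˡ _)
    (antisym (0≤p a) (≤-resp-≈ refl ∑≈0 (≤-sumA 0≤p a))))
  ... | no  ∑≉0 = trans (sym (*-assoc _ _ _)) (trans (*-congʳ (*-inverseʳ _ ∑≉0)) (*-identityˡ _))

  -- As A is nonempty, the sum of 1 over A has a summand at `element zero` and is therefore at least
  -- 1.
  size≉0 : ¬ suc size-1 · 1# ≈ 0#
  size≉0 N≈0 = 0≉1 (antisym 0≤1 (≤-resp-≈ refl ∑1≈0 (≤-sumA {λ _ → 1#} (λ _ → 0≤1) (element zero))))
    where
    ∑1≈0 : sumA (λ _ → 1#) ≈ 0#
    ∑1≈0 = trans (sumA-const 1#) (trans (*-congʳ N≈0) (zeroˡ 1#))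

  sumA-uniform : sumA uniform ≈ 1#
  sumA-uniform = trans (sumA-const _) (*-inverseʳ _ size≉0)

  uniform-distribution : IsDistributionOnA uniform
  uniform-distribution = distributionOnA
    (λ _ → x*y≈1⇒y-nonNeg 0≤N (*-inverseʳ _ size≉0)) sumA-uniform
    where
    0≤N : 0# ≤ suc size-1 · 1#
    0≤N = ≤-resp-≈ refl (trans (sumA-const 1#) (*-identityʳ _)) (sumA-nonNeg {λ _ → 1#} λ _ → 0≤1)

  module _ {D : Domain} (𝕏 : Team D) (x : Var) where
    private
      infix 8 _⟨_⟩

      w = weight₀ 𝕏
      d = x ∈? D

      _⟨_⟩ : Assignment D → A → Assignment (D ∪[ x ])
      t ⟨ a ⟩ = _[_/_] {D} t a x

    -- F t a = g(t(a/x)) / ∑ₐ g(t(a/x)), computed at the representative of t so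
    -- that it is the same for all assignments that agree with t except at x.
    realise-[/ᶠ] : (g : Assignment (D ∪[ x ]) → Carrier) → (∀ s → 0# ≤ g s) →
      (∀ t → sumA (λ a → g (t ⟨ a ⟩)) ≈ sumOver D x d w t) →
      ∃[ F ] (∀ t → IsDistributionOnA (F t)) × (∀ s → weight₀ (𝕏 [ F /ᶠ x ]) s ≈ g s)
    realise-[/ᶠ] g 0≤g ∑g≈∑w = F , (λ t → normalise-distribution λ a → 0≤g _) , λ s →
      let (t , t⟨a⟩≡s) = update-value D x s in
      ≡.subst (λ s → weight₀ (𝕏 [ F /ᶠ x ]) s ≈ g s) t⟨a⟩≡s (at-update t _)
      where
      r = representative D x d
      G : Assignment D → A → Carrier
      G t a = g (t ⟨ a ⟩)
      F : Assignment D → A → Carrier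
      F t = normalise (G (r t))
      G-r : ∀ t a → G (r t) a ≈ G t a
      G-r t a = reflexive (≡.cong g (update-representative D x d t a))
      at-update : ∀ t a → weight₀ (𝕏 [ F /ᶠ x ]) (t ⟨ a ⟩) ≈ G t a
      at-update t a = begin
        weight₀ (𝕏 [ F /ᶠ x ]) (t ⟨ a ⟩)
          ≈⟨ weight₀-[/ᶠ]-update 𝕏 F x t a ⟩
        sumOver D x d (λ t′ → w t′ * F t′ a) t
          -- Throughout the class of t the representatives are identical, and hence so are the
          -- arguments of `normalise`. Pointwise equality of those arguments would not yield this
          -- without a congruence for `normalise`.
          ≈⟨ sumOver-cong D x d t (λ t′ e → *-congˡ (reflexive (≡.cong (λ t → normalise (G t) a) e))) ⟩
        sumOver D x d (λ t′ → w t′ * F t a) t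
          ≈⟨ *-distribʳ-sumOver D x d (F t a) w t ⟨
        sumOver D x d w t * F t a
          ≈⟨ *-congʳ (∑g≈∑w t) ⟨
        sumA (G t) * F t a
          ≈⟨ *-congʳ (sumA-cong (G-r t)) ⟨
        sumA (G (r t)) * F t a
          ≈⟨ sumA*normalise (λ b → 0≤g _) a ⟩
        G (r t) a
          ≈⟨ G-r t a ⟩
        G t a ∎

    -- The sum over an argument that does not occur is multiplication by the size of A, which
    -- cancels the uniform weight. This rephrases uniformity without a constant or a division.
    [A/]-sumA : ∀ t a → sumA (λ _ → weight₀ (𝕏 [A/ x ]) (t ⟨ a ⟩)) ≈ sumOver D x d w t
    [A/]-sumA t a = begin
      sumA (λ _ → weight₀ (𝕏 [A/ x ]) (t ⟨ a ⟩))
        ≈⟨ sumA-const _ ⟩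
      N * weight₀ (𝕏 [A/ x ]) (t ⟨ a ⟩)
        ≈⟨ *-congˡ (weight₀-[/ᶠ]-update 𝕏 (λ _ → uniform) x t a) ⟩
      N * sumOver D x d (λ t′ → w t′ * uniform a) t
        ≈⟨ *-congˡ (*-distribʳ-sumOver D x d (uniform a) w t) ⟨
      N * (sumOver D x d w t * uniform a)
        ≈⟨ *-congˡ (*-comm _ _) ⟩
      N * (uniform a * sumOver D x d w t)
        ≈⟨ *-assoc _ _ _ ⟨
      N * uniform a * sumOver D x d w t
        ≈⟨ *-congʳ (*-inverseʳ _ size≉0) ⟩
      1# * sumOver D x d w t
        ≈⟨ *-identityˡ _ ⟩
      sumOver D x d w t ∎
      where
      N = suc size-1 · 1#

    -- The equations fix g up to the factor |A|, which is nonzero and can be cancelled. So an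
    -- existentially quantified g satisfying them can only be the weight function of 𝕏(A/x).
    [A/]-unique : (g : Assignment (D ∪[ x ]) → Carrier) →
      (∀ t a → sumA (λ _ → g (t ⟨ a ⟩)) ≈ sumOver D x d w t) →
      ∀ s → weight₀ (𝕏 [A/ x ]) s ≈ g s
    [A/]-unique g ∑g≈∑w s =
      let (t , t⟨a⟩≡s) = update-value D x s in
      ≡.subst (λ s → weight₀ (𝕏 [A/ x ]) s ≈ g s) t⟨a⟩≡s (at-update t _)
      where
      at-update : ∀ t a → weight₀ (𝕏 [A/ x ]) (t ⟨ a ⟩) ≈ g (t ⟨ a ⟩)
      at-update t a = *-cancelˡ-≈ size≉0 (begin
        suc size-1 · 1# * weight₀ (𝕏 [A/ x ]) (t ⟨ a ⟩) ≈⟨ sumA-const _ ⟨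
        sumA (λ _ → weight₀ (𝕏 [A/ x ]) (t ⟨ a ⟩))      ≈⟨ [A/]-sumA t a ⟩
        sumOver D x d w t                               ≈⟨ ∑g≈∑w t a ⟨
        sumA (λ _ → g (t ⟨ a ⟩))                        ≈⟨ sumA-const _ ⟩
        suc size-1 · 1# * g (t ⟨ a ⟩)                   ∎)

  -- Convex combinations expressed by distributions

  ConvexCombination : ∀ {m} (f g h : Vec A m → Carrier) → Carrier → Set
  ConvexCombination f g h k = ∀ s → f s ≈ k * g s + (1# - k) * h s

  -- A joint distribution p of a coin b with law q and a tuple s: the outcome a draws s from g,
  -- every other outcome draws it from h, and f is the marginal of p on s.
  record Mixture {m} (f g h : Vec A m → Carrier)
                 (q : Vec A 1 → Carrier) (p : Vec A (suc m) → Carrier) (a : A) : Set where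
    field
      cases : ∀ b s → (b ≡ a × p (b ∷ s) ≈ q (b ∷ []) * g s) ⊎ (¬ b ≡ a × p (b ∷ s) ≈ q (b ∷ []) * h s)
      total : ∀ s → f s ≈ sumA λ b → p (b ∷ s)

  -- The summands away from a have total weight 1 - q a. Adding q a * y to both sides completes them
  -- to a sum of q b * y over all of A, so that no sum over the complement of a has to be formed.
  sumA-cases : ∀ {q c : A → Carrier} {a x y} → sumA q ≈ 1# →
    (∀ b → (b ≡ a × c b ≈ q b * x) ⊎ (¬ b ≡ a × c b ≈ q b * y)) →
    sumA c ≈ q a * x + (1# - q a) * y
  sumA-cases {q} {c} {a} {x} {y} ∑q≈1 cases = +-cancelʳ (q a * y) _ _ (begin
    sumA c + q a * y
      ≈⟨ +-congˡ (only y) ⟨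
    sumA c + sumA (λ b → q b * y when (b ≟ a))
      ≈⟨ sumA-distrib-+ c (λ b → q b * y when (b ≟ a)) ⟨
    sumA (λ b → c b + (q b * y when (b ≟ a)))
      ≈⟨ sumA-cong pointwise ⟩
    sumA (λ b → q b * y + (q b * x when (b ≟ a)))
      ≈⟨ sumA-distrib-+ (λ b → q b * y) (λ b → q b * x when (b ≟ a)) ⟩
    sumA (λ b → q b * y) + sumA (λ b → q b * x when (b ≟ a))
      ≈⟨ +-cong (trans (sym (*-distribʳ-sumA y q)) (*-congʳ ∑q≈1)) (only x) ⟩
    1# * y + q a * x
      ≈⟨ +-comm _ _ ⟩
    q a * x + 1# * y
      ≈⟨ +-congˡ (*-congʳ (sym (x-y+y≈x 1# (q a)))) ⟩
    q a * x + (1# - q a + q a) * y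
      ≈⟨ +-congˡ (distribʳ y (1# - q a) (q a)) ⟩
    q a * x + ((1# - q a) * y + q a * y)
      ≈⟨ +-assoc _ _ _ ⟨
    q a * x + (1# - q a) * y + q a * y ∎)
    where
    only : ∀ z → sumA (λ b → q b * z when (b ≟ a)) ≈ q a * z
    only z = trans (sumA-only {λ b → q b * z when (b ≟ a)} a λ b → when-no (b ≟ a)) (when-yes (a ≟ a) ≡.refl)
    pointwise : ∀ b → c b + (q b * y when (b ≟ a)) ≈ q b * y + (q b * x when (b ≟ a))
    pointwise b with b ≟ a | cases b
    ... | yes _   | inj₁ (_   , c≈) = trans (+-comm _ _) (+-congˡ c≈)
    ... | no  b≢a | inj₁ (b≡a , _)  = contradiction b≡a b≢a
    ... | yes b≡a | inj₂ (b≢a , _)  = contradiction b≡a b≢a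
    ... | no  _   | inj₂ (_   , c≈) = +-congʳ c≈

  mixture⇒convex : ∀ {m} {f g h : Vec A m → Carrier} {q p a} → IsDistribution q →
    Mixture f g h q p a → ConvexCombination f g h (q (a ∷ []))
  mixture⇒convex {q = q} q-dist mix s =
    trans (total s) (sumA-cases {λ b → q (b ∷ [])} (proj₂ q-dist) λ b → cases b s)
    where open Mixture mix

  twoPointDistribution : ∀ {k a b} → k ∈[0,1] → ¬ b ≡ a →
    ∃[ q ] IsDistribution {1} q × q (a ∷ []) ≈ k
  twoPointDistribution {k} {a} {b} (0≤k , k≤1) b≢a = (λ c → q (Vec.head c)) ,
    distribution {1} {λ c → q (Vec.head c)}
      (λ c → +-nonNeg (when-nonNeg (Vec.head c ≟ a) 0≤k) (when-nonNeg (Vec.head c ≟ b) (x≤y⇒0≤y-x k≤1)))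
      ∑q≈1 ,
    trans (+-cong (when-yes (a ≟ a) ≡.refl) (when-no (a ≟ b) (b≢a ∘ ≡.sym))) (+-identityʳ k)
    where
    q : A → Carrier
    q c = (k when (c ≟ a)) + (1# - k when (c ≟ b))
    only : ∀ z a → sumA (λ c → z when (c ≟ a)) ≈ z
    only z a = trans (sumA-only {λ c → z when (c ≟ a)} a λ c → when-no (c ≟ a)) (when-yes (a ≟ a) ≡.refl)
    ∑q≈1 : sumA q ≈ 1#
    ∑q≈1 = begin
      sumA q
        ≈⟨ sumA-distrib-+ (λ c → k when (c ≟ a)) (λ c → 1# - k when (c ≟ b)) ⟩
      sumA (λ c → k when (c ≟ a)) + sumA (λ c → 1# - k when (c ≟ b))
        ≈⟨ +-cong (only k a) (only (1# - k) b) ⟩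
      k + (1# - k)
        ≈⟨ +-comm _ _ ⟩
      1# - k + k
        ≈⟨ x-y+y≈x 1# k ⟩
      1# ∎

  module _ {a : A} (A≡a : ∀ b → b ≡ a) where

    singleton-tuples : ∀ {m} (s t : Vec A m) → s ≡ t
    singleton-tuples []      []      = ≡.refl
    singleton-tuples (b ∷ s) (c ∷ t) = ≡.cong₂ _∷_ (≡.trans (A≡a b) (≡.sym (A≡a c))) (singleton-tuples s t)

    singleton-distribution : ∀ {m} {g : Vec A m → Carrier} → IsDistribution g → ∀ s → g s ≈ 1#
    singleton-distribution {m} {g} g-dist s = trans
      (sym (sumVec-only m {g} s λ t t≢s → contradiction (singleton-tuples t s) t≢s)) (proj₂ g-dist)

  -- If A is a singleton, then f = g = h, and k does not matter.
  representableScalar : ∀ {m} {f g h : Vec A m → Carrier} {k} →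
    IsDistribution f → IsDistribution g → IsDistribution h → k ∈[0,1] → ConvexCombination f g h k →
    ∀ a → ∃[ q ] IsDistribution {1} q × ConvexCombination f g h (q (a ∷ []))
  representableScalar {f = f} {g} {h} {k} f-dist g-dist h-dist k∈[0,1] f≈ a with em {∃[ b ] ¬ b ≡ a}
  ... | yes (b , b≢a) = let (q , q-dist , q≈k) = twoPointDistribution k∈[0,1] b≢a in
    q , q-dist , λ s →
      trans (f≈ s) (+-cong (*-congʳ (sym q≈k)) (*-congʳ (+-congˡ (-‿cong (sym q≈k)))))
  ... | no ¬∃ = (λ _ → 1#) ,
    distribution {1} {λ _ → 1#} (λ _ → 0≤1) (sumA-only {λ _ → 1#} a λ b b≢a → contradiction (A≡a b) b≢a) ,
    λ s → begin
      f s                            ≈⟨ singleton-distribution A≡a f-dist s ⟩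
      1#                             ≈⟨ singleton-distribution A≡a g-dist s ⟨
      g s                            ≈⟨ +-identityʳ _ ⟨
      g s + 0#                       ≈⟨ +-cong (*-identityˡ _) (trans (*-congʳ (-‿inverseʳ 1#)) (zeroˡ _)) ⟨
      1# * g s + (1# - 1#) * h s     ∎
    where
    A≡a : ∀ b → b ≡ a
    A≡a b with b ≟ a
    ... | yes b≡a = b≡a
    ... | no  b≢a = contradiction (b , b≢a) ¬∃

  convex⇒mixture : ∀ {m} {f g h : Vec A m → Carrier} {k} →
    IsDistribution f → IsDistribution g → IsDistribution h → k ∈[0,1] → ConvexCombination f g h k →
    ∃[ q ] IsDistribution q × (∃[ p ] IsDistribution p × (∃[ a ] Mixture f g h q p a))
  convex⇒mixture {m} {f} {g} {h} f-dist g-dist h-dist k∈[0,1] f≈ =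
    q , q-dist , p , distribution {suc m} {p} 0≤p ∑p≈1 , a , record { cases = cases ; total = total }
    where
    a = element zero
    scalar = representableScalar f-dist g-dist h-dist k∈[0,1] f≈ a
    q = proj₁ scalar
    q-dist = proj₁ (proj₂ scalar)
    p : Vec A (suc m) → Carrier
    p (b ∷ s) with b ≟ a
    ... | yes _ = q (b ∷ []) * g s
    ... | no  _ = q (b ∷ []) * h s
    0≤p : ∀ t → 0# ≤ p t
    0≤p (b ∷ s) with b ≟ a
    ... | yes _ = *-nonNeg (proj₁ (proj₁ q-dist _)) (proj₁ (proj₁ g-dist s))
    ... | no  _ = *-nonNeg (proj₁ (proj₁ q-dist _)) (proj₁ (proj₁ h-dist s))
    cases : ∀ b s → (b ≡ a × p (b ∷ s) ≈ q (b ∷ []) * g s) ⊎ (¬ b ≡ a × p (b ∷ s) ≈ q (b ∷ []) * h s)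
    cases b s with b ≟ a
    ... | yes b≡a = inj₁ (b≡a , refl)
    ... | no  b≢a = inj₂ (b≢a , refl)
    total : ∀ s → f s ≈ sumA λ b → p (b ∷ s)
    total s = trans (proj₂ (proj₂ scalar) s)
      (sym (sumA-cases {λ b → q (b ∷ [])} {λ b → p (b ∷ s)} (proj₂ q-dist) λ b → cases b s))
    -- Summing over b first leaves f, so p inherits its total from f.
    ∑p≈1 : sumVec (suc m) p ≈ 1#
    ∑p≈1 = begin
      sumVec (suc m) p                        ≈⟨ sumA-sumVec-comm m (λ b s → p (b ∷ s)) ⟩
      sumVec m (λ s → sumA λ b → p (b ∷ s))   ≈⟨ sumVec-cong m total ⟨
      sumVec m f                              ≈⟨ proj₂ f-dist ⟩
      1#                                      ∎

  -- A nonzero x can be cancelled from x * x = x * 1.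
  ≈0⇔idempotent≉1 : ∀ {x} → (x ≈ 0#) ⇔ ((x * x ≈ x) × ¬ x ≈ 1#)
  ≈0⇔idempotent≉1 {x} = mk⇔ forth back
    where
    forth : x ≈ 0# → (x * x ≈ x) × ¬ x ≈ 1#
    forth x≈0 = trans (*-congˡ x≈0) (trans (zeroʳ x) (sym x≈0)) , λ x≈1 → 0≉1 (trans (sym x≈0) x≈1)
    back : (x * x ≈ x) × ¬ x ≈ 1# → x ≈ 0#
    back (xx≈x , x≉1) with em {x ≈ 0#}
    ... | yes x≈0 = x≈0
    ... | no  x≉0 = contradiction (*-cancelˡ-≈ x≉0 (trans xx≈x (sym (*-identityʳ x)))) x≉1

-- The translation

module Translation {τ : Vocabulary} where

  -- Only atoms can be negated, so negation is pushed down to them. `exF` and `allF` are dual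
  -- because they range over the same distributions.
  neg : ∀ {Γ n} → SO τ Γ n → SO τ Γ n
  neg (i ≐ j)    = i ≐̸ j
  neg (i ≐̸ j)    = i ≐ j
  neg (rel R x̄)  = ¬rel R x̄
  neg (¬rel R x̄) = rel R x̄
  neg (φ ∧ ψ)    = neg φ ∨ neg ψ
  neg (φ ∨ ψ)    = neg φ ∧ neg ψ
  neg (ex φ)     = all (neg φ)
  neg (all φ)    = ex (neg φ)
  neg (exF r φ)  = allF r (neg φ)
  neg (allF r φ) = exF r (neg φ)

  alls : ∀ {Γ n} m → SO τ Γ (m ℕ.+ n) → SO τ Γ n
  alls zero    φ = φ
  -- The new quantifier goes innermost, where it binds index 0; thus the first entry of the tuple is
  -- the first variable, as in `t ++ s`.
  alls (suc m) φ = alls m (all φ)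

  vars : ∀ m n → Vec (Fin (m ℕ.+ n)) m
  vars m n = Vec.tabulate (_↑ˡ n)

  weaken : ∀ {n m} → Vec (Fin n) m → Vec (Fin (suc n)) m
  weaken = Vec.map suc

  total : ∀ {Γ n r} → r ∈ Γ → NumTerm Γ n
  total {n = n} {r} f = SUM r (app f (vars r n))

  -- The total of a distribution f is 1, and 0 is the idempotent other than 1.
  isZero : ∀ {Γ n r} → r ∈ Γ → NumTerm Γ n → SO τ Γ n
  isZero f i = (i ⊗ i ≐ i) ∧ (i ≐̸ total f)

  position : (D : Domain) → ∃[ x ] x ∈ D → Fin (length D)
  position D (_ , x∈D) = index x∈D

  -- A tuple such as x̄ȳ may repeat variables, but the weight of the assignments agreeing with a
  -- given one on it depends only on the set of its variables. A subset also has a complement to sum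
  -- over.
  positions : ∀ (D : Domain) {m} → Tuple D m → Subset (length D)
  positions D []       = ∅
  positions D (x ∷ x̄) = ⁅ position D x ⁆ ∪ positions D x̄

  #outside : ∀ {m} → Subset m → ℕ
  #outside []            = 0
  #outside (inside  ∷ p) = #outside p
  #outside (outside ∷ p) = suc (#outside p)

  -- Positions inside p keep their given variable, shifted past the variables bound by the sum; the
  -- positions outside p receive those bound variables in order.
  mixed : ∀ {m n} (p : Subset m) → Vec (Fin n) m → Vec (Fin (#outside p ℕ.+ n)) m
  mixed []            []       = []
  mixed (inside  ∷ p) (t ∷ ts) = (#outside p ↑ʳ t) ∷ mixed p ts
  mixed (outside ∷ p) (t ∷ ts) = zero ∷ weaken (mixed p ts)

  marginal : ∀ {Γ m n} → m ∈ Γ → Subset m → Vec (Fin n) m → NumTerm Γ n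
  marginal f p ts = SUM (#outside p) (app f (mixed p ts))

  updateVars : ∀ {n} (D : Domain) (x : Var) → Vec (Fin n) (length D) → ∀ d → Vec (Fin (suc n)) (length (insert D x d))
  updateVars D x ts (yes x∈D) = weaken ts [ index x∈D ]≔ zero
  updateVars D x ts (no  _)   = zero ∷ weaken ts

  sumOverTerm : ∀ {Γ n} (D : Domain) (x : Var) → Dec (x ∈ D) → length D ∈ Γ → Vec (Fin n) (length D) → NumTerm Γ n
  sumOverTerm D x (yes x∈D) f ts = SUM 1 (app f (weaken ts [ index x∈D ]≔ zero))
  sumOverTerm D x (no  _)   f ts = app f ts

  -- f = k g + (1 - k) h, without constants and without +: with k = q(a) and
  -- p(b, s) = q(b) g(s) or q(b) h(s) according as b = a or not, f(s) = ∑_b p(b, s).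
  mixture : ∀ {Γ n m} (f g h : m ∈ Γ) → 1 ∈ Γ → suc m ∈ Γ → SO τ Γ n
  mixture {n = n} {m} f g h q p = ex
    (all (alls m ((rel  equality (b ∷ a ∷ []) ∧ (app p (b ∷ ts) ≐ app q (b ∷ []) ⊗ app g ts)) ∨
                  (¬rel equality (b ∷ a ∷ []) ∧ (app p (b ∷ ts) ≐ app q (b ∷ []) ⊗ app h ts))))
     ∧ alls m (app f (vars m (suc n)) ≐ SUM 1 (app p (zero ∷ weaken (vars m (suc n))))))
    where
    ts = vars m (suc (suc n))
    -- The m variables of the tuple s are bound inside b and a, which therefore move up by m.
    b = m ↑ʳ zero
    a = m ↑ʳ suc zero

  tr : ∀ {D Γ n} → FO⫫∼ τ D → length D ∈ Γ → SO τ Γ n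
  tr {D} {n = n} (rel R x̄)  f = alls (length D)
    (isZero f (app f (vars (length D) n)) ∨ rel R (Vec.map ((_↑ˡ n) ∘ position D) x̄))
  tr {D} {n = n} (¬rel R x̄) f = alls (length D)
    (isZero f (app f (vars (length D) n)) ∨ ¬rel R (Vec.map ((_↑ˡ n) ∘ position D) x̄))
  tr {D} {n = n} (ȳ ⫫[ x̄ ] z̄) f = alls (length D)
    (∣ x̄ Vec.++ ȳ ∣ ⊗ ∣ x̄ Vec.++ z̄ ∣ ≐ ∣ x̄ Vec.++ ȳ Vec.++ z̄ ∣ ⊗ ∣ x̄ ∣)
    where
    ∣_∣ : ∀ {l} → Tuple D l → NumTerm _ (length D ℕ.+ n)
    ∣ x̄ ∣ = marginal f (positions D x̄) (vars (length D) n)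
  tr (∼ φ)   f = neg (tr φ f)
  tr (φ ∧ ψ) f = tr φ f ∧ tr ψ f
  tr {D} {Γ} (φ ∨ ψ) f =
    exF m (exF m (exF 1 (exF (suc m) (mixture (there (there (there (there f)))) g h q p ∧ (tr φ g ∧ tr ψ h)))))
    where
    m = length D
    Γ′ = suc m ∷ 1 ∷ m ∷ m ∷ Γ
    p : suc m ∈ Γ′
    p = here ≡.refl
    q : 1 ∈ Γ′
    q = there (here ≡.refl)
    h g : m ∈ Γ′
    h = there (there (here ≡.refl))
    g = there (there (there (here ≡.refl)))
  tr {D} {n = n} (ex x φ) f = exF (length (D ∪[ x ]))
    (alls (length D)
      (SUM 1 (app (here ≡.refl) (updateVars D x ts (x ∈? D))) ≐ sumOverTerm D x (x ∈? D) (there f) ts)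
     ∧ tr φ (here ≡.refl))
    where
    ts = vars (length D) n
  tr {D} {n = n} (all x φ) f = exF (length (D ∪[ x ]))
    (alls (length D) (all
      -- `weaken` keeps the variable of `SUM 1` from occurring, so the left side is the size of A
      -- times g(t(a/x)). In the clause for `ex` the summation variable is instead the value of x.
      (SUM 1 (app (here ≡.refl) (weaken (updateVars D x ts (x ∈? D)))) ≐
       sumOverTerm D x (x ∈? D) (there f) (weaken ts)))
     ∧ tr φ (here ≡.refl))
    where
    ts = vars (length D) n

-- Correctness of the translation

module Correctness (em : ExcludedMiddle 0ℓ) (ℝ : CompleteOrderedField) {τ : Vocabulary} (𝒜 : Structure τ) where
  open CompleteOrderedField ℝ hiding (zero)
  open Structure 𝒜
  open FiniteSums ℝ 𝒜
  open SumProperties ℝ 𝒜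
  open TeamSemantics ℝ 𝒜
  open SOSemantics ℝ 𝒜
  open TeamProperties ℝ 𝒜
  open ChoiceProperties em ℝ 𝒜
  open Translation {τ}
  open SetoidReasoning setoid

  -- Excluded middle is what lets a negation pass through a conjunction or a universal quantifier,
  -- and cancels the double negation of an atom.
  neg-⊨ : ∀ {Γ n} (ρ : FunctionEnv Γ) (s : Vec A n) (ψ : SO τ Γ n) →
    (ρ ∣ s ⊨ neg ψ) ⇔ (¬ ρ ∣ s ⊨ ψ)
  neg-⊨ ρ s (i ≐ j)    = mk⇔ (λ ¬p → ¬p) (λ ¬p → ¬p)
  neg-⊨ ρ s (i ≐̸ j)    = mk⇔ (λ p ¬p → ¬p p) (decidable-stable em)
  neg-⊨ ρ s (rel R x̄)  = mk⇔ (λ ¬p → ¬p) (λ ¬p → ¬p)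
  neg-⊨ ρ s (¬rel R x̄) = mk⇔ (λ p ¬p → ¬p p) (decidable-stable em)
  neg-⊨ ρ s (φ ∧ ψ)    = mk⇔
    (λ { (inj₁ ¬p) (p , _) → to (neg-⊨ ρ s φ) ¬p p ; (inj₂ ¬q) (_ , q) → to (neg-⊨ ρ s ψ) ¬q q })
    back
    where
    back : ¬ ρ ∣ s ⊨ (φ ∧ ψ) → ρ ∣ s ⊨ neg (φ ∧ ψ)
    back ¬pq with em {ρ ∣ s ⊨ φ}
    ... | yes p = inj₂ (from (neg-⊨ ρ s ψ) λ q → ¬pq (p , q))
    ... | no ¬p = inj₁ (from (neg-⊨ ρ s φ) ¬p)
  neg-⊨ ρ s (φ ∨ ψ)    = mk⇔
    (λ { (¬p , _) (inj₁ p) → to (neg-⊨ ρ s φ) ¬p p ; (_ , ¬q) (inj₂ q) → to (neg-⊨ ρ s ψ) ¬q q })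
    (λ ¬pq → from (neg-⊨ ρ s φ) (¬pq ∘ inj₁) , from (neg-⊨ ρ s ψ) (¬pq ∘ inj₂))
  neg-⊨ ρ s (ex φ)     = mk⇔
    (λ { ∀¬p (a , p) → to (neg-⊨ ρ (a ∷ s) φ) (∀¬p a) p })
    (λ ¬∃p a → from (neg-⊨ ρ (a ∷ s) φ) λ p → ¬∃p (a , p))
  neg-⊨ ρ s (all φ)    = mk⇔
    (λ { (a , ¬p) ∀p → to (neg-⊨ ρ (a ∷ s) φ) ¬p (∀p a) })
    (λ ¬∀p → decidable-stable em λ ¬∃¬p → ¬∀p λ a → decidable-stable em λ ¬p →
      ¬∃¬p (a , from (neg-⊨ ρ (a ∷ s) φ) ¬p))
  neg-⊨ ρ s (exF r φ)  = mk⇔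
    (λ { ∀¬p (g , dist , p) → to (neg-⊨ (g ∷ ρ) s φ) (∀¬p g dist) p })
    (λ ¬∃p g dist → from (neg-⊨ (g ∷ ρ) s φ) λ p → ¬∃p (g , dist , p))
  neg-⊨ ρ s (allF r φ) = mk⇔
    (λ { (g , dist , ¬p) ∀p → to (neg-⊨ (g ∷ ρ) s φ) ¬p (∀p g dist) })
    (λ ¬∀p → decidable-stable em λ ¬∃¬p → ¬∀p λ g dist → decidable-stable em λ ¬p →
      ¬∃¬p (g , dist , from (neg-⊨ (g ∷ ρ) s φ) ¬p))

  alls-⊨ : ∀ {Γ n} (ρ : FunctionEnv Γ) (s : Vec A n) m (ψ : SO τ Γ (m ℕ.+ n)) →
    (ρ ∣ s ⊨ alls m ψ) ⇔ (∀ t → ρ ∣ t Vec.++ s ⊨ ψ)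
  alls-⊨ ρ s zero    ψ = mk⇔ (λ { p [] → p }) (λ p → p [])
  alls-⊨ ρ s (suc m) ψ = mk⇔
    (λ { p (a ∷ t) → to (alls-⊨ ρ s m (all ψ)) p t a })
    (λ p → from (alls-⊨ ρ s m (all ψ)) λ t a → p (a ∷ t))

  _‼_ : ∀ {m n} → Vec A n → Vec (Fin n) m → Vec A m
  s ‼ ts = Vec.map (Vec.lookup s) ts

  ‼-vars : ∀ {m n} (t : Vec A m) (s : Vec A n) → (t Vec.++ s) ‼ vars m n ≡ t
  ‼-vars {m} {n} t s = ≡.trans
    (≡.sym (tabulate-∘ (Vec.lookup (t Vec.++ s)) (_↑ˡ n)))
    (≡.trans (tabulate-cong (lookup-++ˡ t s)) (tabulate∘lookup t))

  ‼-weaken : ∀ {m n} a (s : Vec A n) (ts : Vec (Fin n) m) → (a ∷ s) ‼ weaken ts ≡ s ‼ ts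
  ‼-weaken a s ts = ≡.sym (map-∘ (Vec.lookup (a ∷ s)) suc ts)

  ‼-update : ∀ {n} (D : Domain) (x : Var) d a (s : Vec A n) (ts : Vec (Fin n) (length D)) →
    (a ∷ s) ‼ updateVars D x ts d ≡ update {D} (s ‼ ts) a x d
  ‼-update D x (yes x∈D) a s ts = ≡.trans (map-[]≔ (Vec.lookup (a ∷ s)) (weaken ts) (index x∈D))
    (≡.cong (_[ index x∈D ]≔ a) (‼-weaken a s ts))
  ‼-update D x (no  _)   a s ts = ≡.cong (a ∷_) (‼-weaken a s ts)

  ‼-positions : ∀ (D : Domain) {m n} (t : Assignment D) (s : Vec A n) (x̄ : Tuple D m) →
    (t Vec.++ s) ‼ Vec.map ((_↑ˡ n) ∘ position D) x̄ ≡ values {D} t x̄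
  ‼-positions D {n = n} t s x̄ = ≡.trans
    (≡.sym (map-∘ (Vec.lookup (t Vec.++ s)) ((_↑ˡ n) ∘ position D) x̄))
    (map-cong (λ x → lookup-++ˡ t s (position D x)) x̄)

  Agree : ∀ {m} → Subset m → Vec A m → Vec A m → Set
  Agree p t′ t = ∀ i → i ∈ₛ p → Vec.lookup t′ i ≡ Vec.lookup t i

  agree? : ∀ {m} (p : Subset m) (t′ t : Vec A m) → Dec (Agree p t′ t)
  agree? p t′ t = em

  -- The values of the bound variables enumerate once each tuple with the prescribed entries at the
  -- positions in p. At such a position the sum over A collapses to the prescribed entry; at any
  -- other position it is a bound sum on both sides.
  sumVec-mixed : ∀ {m n} (p : Subset m) (ts : Vec (Fin n) m) (s : Vec A n) (g : Vec A m → Carrier) →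
    sumVec (#outside p) (λ b̄ → g ((b̄ Vec.++ s) ‼ mixed p ts)) ≈
    sumVec m λ t → g t when agree? p t (s ‼ ts)
  sumVec-mixed []            []       s g = sym (when-yes (agree? [] [] []) λ _ ())
  sumVec-mixed {suc m} (inside  ∷ p) (i ∷ ts) s g = begin
    sumVec (#outside p) (λ b̄ → g (Vec.lookup (b̄ Vec.++ s) (#outside p ↑ʳ i) ∷ ((b̄ Vec.++ s) ‼ mixed p ts)))
      ≈⟨ sumVec-cong (#outside p) (λ b̄ →
           reflexive (≡.cong (λ c → g (c ∷ ((b̄ Vec.++ s) ‼ mixed p ts))) (lookup-++ʳ b̄ s i))) ⟩
    sumVec (#outside p) (λ b̄ → g (c ∷ ((b̄ Vec.++ s) ‼ mixed p ts)))
      ≈⟨ sumVec-mixed p ts s (g ∘ (c ∷_)) ⟩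
    sumVec m (λ t → g (c ∷ t) when agree? p t (s ‼ ts))
      ≈⟨ sumVec-cong m (λ t → when-⇔ (agree? p t (s ‼ ts)) (agree?∷ c t)
           (λ agree → λ { zero here → ≡.refl ; (suc i) (there i∈p) → agree i i∈p })
           (λ agree i i∈p → agree (suc i) (there i∈p)) refl) ⟩
    sumVec m (λ t → g (c ∷ t) when agree?∷ c t)
      ≈⟨ sumA-only {λ b → sumVec m λ t → g (b ∷ t) when agree?∷ b t} c (λ b b≢c →
           sumVec-0 m λ t → when-no (agree?∷ b t) λ agree → b≢c (agree zero here)) ⟨
    sumA (λ b → sumVec m λ t → g (b ∷ t) when agree?∷ b t) ∎
    where
    c = Vec.lookup s i
    agree?∷ = λ b t → agree? (inside ∷ p) (b ∷ t) (c ∷ (s ‼ ts))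
  sumVec-mixed {suc m} (outside ∷ p) (i ∷ ts) s g = sumA-cong λ b → begin
    sumVec (#outside p) (λ b̄ → g (b ∷ ((b ∷ (b̄ Vec.++ s)) ‼ weaken (mixed p ts))))
      ≈⟨ sumVec-cong (#outside p) (λ b̄ →
           reflexive (≡.cong (λ t → g (b ∷ t)) (‼-weaken b (b̄ Vec.++ s) (mixed p ts)))) ⟩
    sumVec (#outside p) (λ b̄ → g (b ∷ ((b̄ Vec.++ s) ‼ mixed p ts)))
      ≈⟨ sumVec-mixed p ts s (g ∘ (b ∷_)) ⟩
    sumVec m (λ t → g (b ∷ t) when agree? p t (s ‼ ts))
      ≈⟨ sumVec-cong m (λ t → when-⇔ (agree? p t (s ‼ ts)) (agree?∷ b t)
           (λ agree → λ { (suc i) (there i∈p) → agree i i∈p })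
           (λ agree i i∈p → agree (suc i) (there i∈p)) refl) ⟩
    sumVec m (λ t → g (b ∷ t) when agree?∷ b t) ∎
    where
    agree?∷ = λ b t → agree? (outside ∷ p) (b ∷ t) (Vec.lookup s i ∷ (s ‼ ts))

  Agree-positions : ∀ (D : Domain) {m} (x̄ : Tuple D m) (t′ t : Assignment D) →
    Agree (positions D x̄) t′ t ⇔ (values {D} t′ x̄ ≡ values {D} t x̄)
  Agree-positions D []       t′ t = mk⇔ (λ _ → ≡.refl) (λ _ i i∈∅ → contradiction i∈∅ ∉⊥)
  Agree-positions D (x ∷ x̄) t′ t = mk⇔
    (λ agree → ≡.cong₂ _∷_ (agree _ (x∈p∪q⁺ (inj₁ (x∈⁅x⁆ (position D x)))))
      (to (Agree-positions D x̄ t′ t) λ i i∈ → agree i (x∈p∪q⁺ {p = ⁅ position D x ⁆} (inj₂ i∈))))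
    (λ e i i∈ → back e i (x∈p∪q⁻ ⁅ position D x ⁆ (positions D x̄) i∈))
    where
    back : values {D} t′ (x ∷ x̄) ≡ values {D} t (x ∷ x̄) →
      ∀ i → (i ∈ₛ ⁅ position D x ⁆) ⊎ (i ∈ₛ positions D x̄) → Vec.lookup t′ i ≡ Vec.lookup t i
    back e i (inj₁ i∈) with ≡.refl ← x∈⁅y⁆⇒x≡y (position D x) i∈ = ∷-injectiveˡ e
    back e i (inj₂ i∈) = from (Agree-positions D x̄ t′ t) (∷-injectiveʳ e) i i∈



  module _ {Γ} (ρ : FunctionEnv Γ) where

    eval-app : ∀ {r n} (f : r ∈ Γ) (s : Vec A n) {ts t} → s ‼ ts ≡ t →
      eval ρ s (app f ts) ≈ All.lookup ρ f t
    eval-app f s e = reflexive (≡.cong (All.lookup ρ f) e)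

    eval-total : ∀ {r n} (f : r ∈ Γ) (s : Vec A n) → eval ρ s (total f) ≈ sumVec r (All.lookup ρ f)
    eval-total {r} f s = sumVec-cong r λ t → eval-app f (t Vec.++ s) (‼-vars t s)

    isZero-⊨ : ∀ {r n} (f : r ∈ Γ) (s : Vec A n) → IsDistribution (All.lookup ρ f) → ∀ i →
      (ρ ∣ s ⊨ isZero f i) ⇔ (eval ρ s i ≈ 0#)
    isZero-⊨ f s dist i = mk⇔
      (λ { (ii≈i , i≉total) → from ≈0⇔idempotent≉1 (ii≈i , λ i≈1 → i≉total (trans i≈1 (sym total≈1))) })
      (λ i≈0 → let (ii≈i , i≉1) = to ≈0⇔idempotent≉1 i≈0 in ii≈i , λ i≈total → i≉1 (trans i≈total total≈1))
      where
      total≈1 : eval ρ s (total f) ≈ 1#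
      total≈1 = trans (eval-total f s) (proj₂ dist)

    eval-sumOver : ∀ {n} (D : Domain) (x : Var) d (f : length D ∈ Γ) (s : Vec A n) {ts t} → s ‼ ts ≡ t →
      eval ρ s (sumOverTerm D x d f ts) ≈ sumOver D x d (All.lookup ρ f) t
    eval-sumOver D x (yes x∈D) f s {ts} ≡.refl =
      sumA-cong λ a → eval-app f (a ∷ s) (‼-update D x (yes x∈D) a s ts)
    eval-sumOver D x (no  _)   f s e = eval-app f s e

    module _ {D : Domain} (f : length D ∈ Γ) (𝕏 : Team D) (w≈f : ∀ t → weight₀ 𝕏 t ≈ All.lookup ρ f t)
             {n} (s : Vec A n) where

      eval-marginal : ∀ {m} (x̄ : Tuple D m) (t : Assignment D) →
        eval ρ (t Vec.++ s) (marginal f (positions D x̄) (vars (length D) n)) ≈ ∣ 𝕏 ∣[ x̄ ≔ values {D} t x̄ ]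
      eval-marginal x̄ t = begin
        eval ρ (t Vec.++ s) (marginal f (positions D x̄) (vars (length D) n))
          ≈⟨ sumVec-mixed (positions D x̄) (vars (length D) n) (t Vec.++ s) (All.lookup ρ f) ⟩
        sumVec (length D) (λ t′ → All.lookup ρ f t′ when agree? (positions D x̄) t′ tˢ)
          ≈⟨ sumVec-cong (length D) (λ t′ → when-⇔ (agree? (positions D x̄) t′ tˢ) (values {D} t′ x̄ ≟* values {D} t x̄)
               (λ agree → to (Agree-positions D x̄ t′ t) λ i i∈ → ≡.trans (agree i i∈) (lookup-vars i))
               (λ e i i∈ → ≡.trans (from (Agree-positions D x̄ t′ t) e i i∈) (≡.sym (lookup-vars i)))
               (sym (w≈f t′))) ⟩
        ∣ 𝕏 ∣[ x̄ ≔ values {D} t x̄ ] ∎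
        where
        tˢ = (t Vec.++ s) ‼ vars (length D) n
        lookup-vars : ∀ i → Vec.lookup tˢ i ≡ Vec.lookup t i
        lookup-vars i = ≡.cong (λ t → Vec.lookup t i) (‼-vars t s)

      -- Quantification over the support becomes quantification over all assignments, with weight 0
      -- as an alternative. The property P is left open so that both kinds of literal are covered.
      supp-⊨ : IsProbabilistic 𝕏 → ∀ {P : Assignment D → Set} {χ : SO τ Γ (length D ℕ.+ n)} →
        (∀ t → (ρ ∣ t Vec.++ s ⊨ χ) ⇔ P t) →
        (∀ t → _∈supp_ {D} t 𝕏 → P t) ⇔
        (ρ ∣ s ⊨ alls (length D) (isZero f (app f (vars (length D) n)) ∨ χ))
      supp-⊨ prob {P} {χ} χ⇔P = mk⇔
        (λ p → from (alls-⊨ ρ s (length D) _) λ t → forth t (p t))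
        (λ p t t∈supp → back t t∈supp (to (alls-⊨ ρ s (length D) _) p t))
        where
        dist = IsDistribution-resp-≈ w≈f (weight₀-distribution 𝕏 prob)
        isZero⇔ = λ t → isZero-⊨ f (t Vec.++ s) dist (app f (vars (length D) n))
        eval≈w : ∀ t → eval ρ (t Vec.++ s) (app f (vars (length D) n)) ≈ weight₀ 𝕏 t
        eval≈w t = trans (eval-app f (t Vec.++ s) (‼-vars t s)) (sym (w≈f t))
        forth : ∀ t → (_∈supp_ {D} t 𝕏 → P t) →
          ρ ∣ t Vec.++ s ⊨ (isZero f (app f (vars (length D) n)) ∨ χ)
        forth t p with em {weight₀ 𝕏 t ≈ 0#}
        ... | yes w≈0 = inj₁ (from (isZero⇔ t) (trans (eval≈w t) w≈0))
        ... | no  w≉0 = inj₂ (from (χ⇔P t) (p (weight₀≉0⇒∈supp 𝕏 w≉0)))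
        back : ∀ t → _∈supp_ {D} t 𝕏 →
          ρ ∣ t Vec.++ s ⊨ (isZero f (app f (vars (length D) n)) ∨ χ) → P t
        back t t∈supp (inj₁ z) = contradiction
          (trans (sym (eval≈w t)) (to (isZero⇔ t) z)) (∈supp⇒weight₀≉0 𝕏 t∈supp)
        back t t∈supp (inj₂ c) = to (χ⇔P t) c

    mixture-⊨ : ∀ {n m} (s : Vec A n) (f g h : m ∈ Γ) (q : 1 ∈ Γ) (p : suc m ∈ Γ) →
      let F = All.lookup ρ in
      (ρ ∣ s ⊨ mixture f g h q p) ⇔ (∃[ a ] Mixture (F f) (F g) (F h) (F q) (F p) a)
    mixture-⊨ {n} {m} s f g h q p = mk⇔
      (λ { (a , cases , total) → a , record
        { cases = λ b t → to (cases⇔ a b t) (to (alls-⊨ ρ (b ∷ a ∷ s) m _) (cases b) t)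
        ; total = λ t → to (total⇔ a t) (to (alls-⊨ ρ (a ∷ s) m _) total t) } })
      (λ { (a , mix) → a ,
        (λ b → from (alls-⊨ ρ (b ∷ a ∷ s) m _) λ t → from (cases⇔ a b t) (Mixture.cases mix b t)) ,
        from (alls-⊨ ρ (a ∷ s) m _) λ t → from (total⇔ a t) (Mixture.total mix t) })
      where
      F : ∀ {r} → r ∈ Γ → Vec A r → Carrier
      F = All.lookup ρ
      ≈-⇔ : ∀ {x x′ y y′} → x ≈ x′ → y ≈ y′ → (x ≈ y) ⇔ (x′ ≈ y′)
      ≈-⇔ x≈x′ y≈y′ = mk⇔ (λ x≈y → trans (sym x≈x′) (trans x≈y y≈y′))
                           (λ x′≈y′ → trans x≈x′ (trans x′≈y′ (sym y≈y′)))
      total⇔ : ∀ a t → _ ⇔ (F f t ≈ sumA λ b → F p (b ∷ t))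
      total⇔ a t = ≈-⇔ (eval-app f S (‼-vars t (a ∷ s)))
        (sumA-cong λ b → eval-app p (b ∷ S) {zero ∷ weaken (vars m (suc n))} (≡.cong (b ∷_)
          (≡.trans (‼-weaken b S (vars m (suc n))) (‼-vars t (a ∷ s)))))
        where
        S = t Vec.++ a ∷ s
      cases⇔ : ∀ a b t → _ ⇔ ((b ≡ a × F p (b ∷ t) ≈ F q (b ∷ []) * F g t) ⊎
                              (¬ b ≡ a × F p (b ∷ t) ≈ F q (b ∷ []) * F h t))
      cases⇔ a b t = (b≡a⇔ ×-⇔ p⇔ g) ⊎-⇔ (mk⇔ (_∘ from b≡a⇔) (_∘ to b≡a⇔) ×-⇔ p⇔ h)
        where
        S = t Vec.++ b ∷ a ∷ s
        lookup-b : Vec.lookup S (m ↑ʳ zero) ≡ b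
        lookup-b = lookup-++ʳ t (b ∷ a ∷ s) zero
        lookup-a : Vec.lookup S (m ↑ʳ suc zero) ≡ a
        lookup-a = lookup-++ʳ t (b ∷ a ∷ s) (suc zero)
        b≡a⇔ : (Vec.lookup S (m ↑ʳ zero) ≡ Vec.lookup S (m ↑ʳ suc zero)) ⇔ (b ≡ a)
        b≡a⇔ = mk⇔ (λ e → ≡.trans (≡.sym lookup-b) (≡.trans e lookup-a))
                   (λ e → ≡.trans lookup-b (≡.trans e (≡.sym lookup-a)))
        S‼ts = ‼-vars t (b ∷ a ∷ s)
        p⇔ : (k : m ∈ Γ) → _ ⇔ (F p (b ∷ t) ≈ F q (b ∷ []) * F k t)
        p⇔ k = ≈-⇔ (eval-app p S (≡.cong₂ _∷_ lookup-b S‼ts))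
          (*-cong (eval-app q S (≡.cong (_∷ []) lookup-b)) (eval-app k S S‼ts))

  -- The environment is arbitrary because every quantifier or disjunction extends it, and f then
  -- changes to the newly bound function. Weights need only be equal to f in the field: a team
  -- rebuilt from a quantified function has that function as its weights only up to `_≈_`, and its
  -- list of assignments may differ.
  correct : ∀ {D Γ n} (φ : FO⫫∼ τ D) (f : length D ∈ Γ) (ρ : FunctionEnv Γ) (s : Vec A n) (𝕏 : Team D) →
    IsProbabilistic 𝕏 → (∀ t → weight₀ 𝕏 t ≈ All.lookup ρ f t) → (𝕏 ⊨ φ) ⇔ (ρ ∣ s ⊨ tr φ f)
  correct {D} (rel R x̄) f ρ s 𝕏 prob w≈f = supp-⊨ ρ f 𝕏 w≈f s prob λ t → mk⇔
    (≡.subst ⟦ R ⟧ (‼-positions D t s x̄)) (≡.subst ⟦ R ⟧ (≡.sym (‼-positions D t s x̄)))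
  correct {D} (¬rel R x̄) f ρ s 𝕏 prob w≈f = supp-⊨ ρ f 𝕏 w≈f s prob λ t → mk⇔
    (≡.subst (¬_ ∘ ⟦ R ⟧) (‼-positions D t s x̄)) (≡.subst (¬_ ∘ ⟦ R ⟧) (≡.sym (‼-positions D t s x̄)))
  correct {D} (ȳ ⫫[ x̄ ] z̄) f ρ s 𝕏 prob w≈f = mk⇔
    (λ p → from (alls-⊨ ρ s (length D) _) λ t →
      trans (*-cong (marg (x̄ Vec.++ ȳ) t) (marg (x̄ Vec.++ z̄) t))
        (trans (p t) (sym (*-cong (marg (x̄ Vec.++ ȳ Vec.++ z̄) t) (marg x̄ t)))))
    (λ p t → trans (sym (*-cong (marg (x̄ Vec.++ ȳ) t) (marg (x̄ Vec.++ z̄) t)))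
      (trans (to (alls-⊨ ρ s (length D) _) p t) (*-cong (marg (x̄ Vec.++ ȳ Vec.++ z̄) t) (marg x̄ t))))
    where
    marg : ∀ {m} (x̄ : Tuple D m) t → _
    marg = eval-marginal ρ f 𝕏 w≈f s
  correct (∼ φ) f ρ s 𝕏 prob w≈f = mk⇔
    (λ ¬p → from (neg-⊨ ρ s (tr φ f)) (¬p ∘ from (correct φ f ρ s 𝕏 prob w≈f)))
    (λ p → to (neg-⊨ ρ s (tr φ f)) p ∘ to (correct φ f ρ s 𝕏 prob w≈f))
  correct (φ ∧ ψ) f ρ s 𝕏 prob w≈f =
    correct φ f ρ s 𝕏 prob w≈f ×-⇔ correct ψ f ρ s 𝕏 prob w≈f
  correct {D} {Γ} {n} (φ ∨ ψ) f ρ s 𝕏 prob w≈f = mk⇔ forth back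
    where
    m = length D
    F = All.lookup ρ f
    F-dist : IsDistribution F
    F-dist = IsDistribution-resp-≈ w≈f (weight₀-distribution 𝕏 prob)

    forth : 𝕏 ⊨ (φ ∨ ψ) → ρ ∣ s ⊨ tr (φ ∨ ψ) f
    forth (𝕐 , ℤ , k , 𝕐-prob , ℤ-prob , k∈[0,1] , 𝕐⊔ℤ≋𝕏 , pφ , pψ) =
      let g-dist = weight₀-distribution 𝕐 𝕐-prob
          h-dist = weight₀-distribution ℤ ℤ-prob
          (q , q-dist , p , p-dist , mix) = convex⇒mixture F-dist g-dist h-dist k∈[0,1] λ t →
            trans (sym (w≈f t)) (trans (sym (𝕐⊔ℤ≋𝕏 t)) (weight₀-⊔ 𝕐 ℤ k t))
          ρ′ = p ∷ q ∷ weight₀ ℤ ∷ weight₀ 𝕐 ∷ ρ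
      in weight₀ 𝕐 , g-dist , weight₀ ℤ , h-dist , q , q-dist , p , p-dist ,
         from (mixture-⊨ ρ′ s _ _ _ _ _) mix ,
         to (correct φ _ ρ′ s 𝕐 𝕐-prob λ _ → refl) pφ ,
         to (correct ψ _ ρ′ s ℤ ℤ-prob λ _ → refl) pψ
    back : ρ ∣ s ⊨ tr (φ ∨ ψ) f → 𝕏 ⊨ (φ ∨ ψ)
    back (g , g-dist , h , h-dist , q , q-dist , p , p-dist , pmix , pφ , pψ) =
      let ρ′ = p ∷ q ∷ h ∷ g ∷ ρ
          (a , mix) = to (mixture-⊨ ρ′ s _ _ _ _ _) pmix
          𝕐 = fullTeam D g
          ℤ = fullTeam D h
          𝕐-prob = fullTeam-probabilistic D g-dist
          ℤ-prob = fullTeam-probabilistic D h-dist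
      in 𝕐 , ℤ , q (a ∷ []) , 𝕐-prob , ℤ-prob , proj₁ q-dist (a ∷ []) ,
         (λ t → trans (weight₀-⊔ 𝕐 ℤ (q (a ∷ [])) t)
           (trans (+-cong (*-congˡ (weight₀-fullTeam D g t)) (*-congˡ (weight₀-fullTeam D h t)))
           (trans (sym (mixture⇒convex q-dist mix t)) (sym (w≈f t))))) ,
         from (correct φ _ ρ′ s 𝕐 𝕐-prob (weight₀-fullTeam D g)) pφ ,
         from (correct ψ _ ρ′ s ℤ ℤ-prob (weight₀-fullTeam D h)) pψ
  correct {D} (ex x φ) f ρ s 𝕏 prob w≈f = mk⇔ forth back
    where
    d = x ∈? D
    m = length D
    w = weight₀ 𝕏
    sumOver≈ : ∀ g t → eval (g ∷ ρ) (t Vec.++ s) (sumOverTerm D x d (there f) (vars m _)) ≈ sumOver D x d w t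
    sumOver≈ g t = trans (eval-sumOver (g ∷ ρ) D x d (there f) (t Vec.++ s) (‼-vars t s))
      (sumOver-cong D x d t λ t′ _ → sym (w≈f t′))
    sum≈ : ∀ (g : Assignment (D ∪[ x ]) → Carrier) t →
      eval (g ∷ ρ) (t Vec.++ s) (SUM 1 (app (here ≡.refl) (updateVars D x (vars m _) d))) ≈
      sumA λ a → g (_[_/_] {D} t a x)
    sum≈ g t = sumA-cong λ a → reflexive (≡.cong g (≡.trans (‼-update D x d a (t Vec.++ s) (vars m _))
      (≡.cong (λ t → _[_/_] {D} t a x) (‼-vars t s))))
    forth : 𝕏 ⊨ ex {D = D} x φ → ρ ∣ s ⊨ tr (ex {D = D} x φ) f
    forth (F , F-dist , p) = g , weight₀-distribution (𝕏 [ F /ᶠ x ]) prob′ ,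
      from (alls-⊨ (g ∷ ρ) s m _) (λ t →
        trans (sum≈ g t) (trans ([/ᶠ]-sumA 𝕏 F x F-dist t) (sym (sumOver≈ g t)))) ,
      to (correct φ (here ≡.refl) (g ∷ ρ) s (𝕏 [ F /ᶠ x ]) prob′ λ _ → refl) p
      where
      g = weight₀ (𝕏 [ F /ᶠ x ])
      prob′ = [/ᶠ]-probabilistic 𝕏 F x F-dist prob
    back : ρ ∣ s ⊨ tr (ex {D = D} x φ) f → 𝕏 ⊨ ex {D = D} x φ
    back (g , g-dist , ∑g , p) =
      let (F , F-dist , w≈g) = realise-[/ᶠ] 𝕏 x g (λ s → proj₁ (proj₁ g-dist s)) λ t →
            trans (sym (sum≈ g t)) (trans (to (alls-⊨ (g ∷ ρ) s m _) ∑g t) (sumOver≈ g t))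
      in F , (λ t _ → F-dist t) ,
        from (correct φ (here ≡.refl) (g ∷ ρ) s (𝕏 [ F /ᶠ x ])
          ([/ᶠ]-probabilistic 𝕏 F x (λ t _ → F-dist t) prob) w≈g) p
  correct {D} (all x φ) f ρ s 𝕏 prob w≈f = mk⇔ forth back
    where
    d = x ∈? D
    m = length D
    w = weight₀ 𝕏
    g₀ = weight₀ (𝕏 [A/ x ])
    prob′ : IsProbabilistic (𝕏 [A/ x ])
    prob′ = [/ᶠ]-probabilistic 𝕏 (λ _ → uniform) x (λ _ _ → uniform-distribution) prob
    sumOver≈ : ∀ g t a →
      eval (g ∷ ρ) (a ∷ t Vec.++ s) (sumOverTerm D x d (there f) (weaken (vars m _))) ≈ sumOver D x d w t
    sumOver≈ g t a = trans
      (eval-sumOver (g ∷ ρ) D x d (there f) (a ∷ t Vec.++ s)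
        (≡.trans (‼-weaken a (t Vec.++ s) (vars m _)) (‼-vars t s)))
      (sumOver-cong D x d t λ t′ _ → sym (w≈f t′))
    sum≈ : ∀ (g : Assignment (D ∪[ x ]) → Carrier) t a →
      eval (g ∷ ρ) (a ∷ t Vec.++ s) (SUM 1 (app (here ≡.refl) (weaken (updateVars D x (vars m _) d)))) ≈
      sumA λ _ → g (_[_/_] {D} t a x)
    sum≈ g t a = sumA-cong λ b → reflexive (≡.cong g (≡.trans
      (‼-weaken b (a ∷ t Vec.++ s) (updateVars D x (vars m _) d))
      (≡.trans (‼-update D x d a (t Vec.++ s) (vars m _)) (≡.cong (λ t → _[_/_] {D} t a x) (‼-vars t s)))))
    forth : 𝕏 ⊨ all {D = D} x φ → ρ ∣ s ⊨ tr (all {D = D} x φ) f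
    forth p = g₀ , weight₀-distribution (𝕏 [A/ x ]) prob′ ,
      from (alls-⊨ (g₀ ∷ ρ) s m _) (λ t a →
        trans (sum≈ g₀ t a) (trans ([A/]-sumA 𝕏 x t a) (sym (sumOver≈ g₀ t a)))) ,
      to (correct φ (here ≡.refl) (g₀ ∷ ρ) s (𝕏 [A/ x ]) prob′ λ _ → refl) p
    back : ρ ∣ s ⊨ tr (all {D = D} x φ) f → 𝕏 ⊨ all {D = D} x φ
    -- The witness g is forced to be the weight function of 𝕏(A/x), so the induction hypothesis
    -- applies to that team with g as its function.
    back (g , g-dist , ∑g , p) = from (correct φ (here ≡.refl) (g ∷ ρ) s (𝕏 [A/ x ]) prob′
      ([A/]-unique 𝕏 x g λ t a →
        trans (sym (sum≈ g t a)) (trans (to (alls-⊨ (g ∷ ρ) s m _) ∑g t a) (sumOver≈ g t a)))) p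

mainTheorem4 : ExcludedMiddle 0ℓ →
    (ℝ : CompleteOrderedField) (τ : Vocabulary) (v̄ : List Var) → Unique v̄ →
    (φ : FO⫫∼ τ v̄) →
    Σ[ ψ ∈ SO τ (length v̄ ∷ []) 0 ]
    (FreeIn zero ψ ×
    ((𝒜 : Structure τ) → let open TeamSemantics ℝ 𝒜 in let open SOSemantics ℝ 𝒜 in
    (𝕏 : Team v̄) → IsProbabilistic 𝕏 → ((𝕏 ⊨ φ) ⇔ (teamFunction 𝕏 ⊨ˢ ψ))))
mainTheorem4 em ℝ τ v̄ _ φ =
  -- The tautology makes f occur.
  (total f ≐ total f) ∧ tr φ f , inj₁ (inj₁ ≡.refl) , λ 𝒜 𝕏 prob →
    let open CompleteOrderedField ℝ using (refl)
        equiv = Correctness.correct em ℝ 𝒜 φ f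
          (TeamSemantics.teamFunction ℝ 𝒜 𝕏 ∷ []) [] 𝕏 prob λ _ → refl
    in mk⇔ (λ p → refl , to equiv p) (λ { (_ , p) → from equiv p })
  where
  open Translation {τ}
  f : length v̄ ∈ length v̄ ∷ []
  f = here ≡.refl
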